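{- Let $p \in (0, 1/2)$ and let $k, d$ be positive integers. There exists a constant $c_{p,k,d}>0$ such that the following holds. Let $G$ be a $k$-partite $k$-uniform hypergraph with $n$ vertices in each part and at least $pn^k$ edges. Then $G$ contains every $k$-partite $k$-uniform hypergraph $H$ with $d_1(H)=d$ on $h$ vertices, where $h \le c_{p, k, d}\,n$.
   Context: A hypergraph is $k$-partite if its vertex set can be partitioned into $k$ parts so that each edge has exactly one vertex in each part. The skeletal degeneracy $d_1(H)$ is the degeneracy of the $1$-skeleton of $H$ (the graph on $V(H)$ joining two vertices iff they lie in a common edge of $H$), i.e. the least $d$ such that every subgraph of that graph has minimum degree at most $d$. -}

module Defs where

open import Data.Nat using (ℕ; zero; suc; _+_; _≤_)
open import Data.Bool using (Bool; true; false; _∧_; _∨_; not)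
open import Data.Fin using (Fin; zero; suc; _≟_)
open import Data.Fin.Subset using (Subset; _∈_; ∣_∣; Nonempty)
open import Data.Fin.Subset.Properties using (_∈?_)
open import Data.List using (List)
open import Data.Bool.ListAction using (any)
open import Data.Integer using (+_)
open import Data.Rational using (ℚ; _/_)
open import Data.List.Membership.Propositional renaming (_∈_ to _∈ₗ_)
open import Data.List.Relation.Unary.All using (All)
open import Data.Product using (_×_; _,_; ∃; ∃-syntax; Σ)
open import Data.Vec using (tabulate)
open import Relation.Binary.PropositionalEquality using (_≡_)
open import Relation.Nullary.Decidable using (⌊_⌋)
open import Function.Definitions using (Injective)

-- Host hypergraph: k-partite k-uniform with parts Fin k, each part of size n
-- (vertex set Fin k × Fin n).  An edge is a choice of one vertex in each part,
-- i.e. a function f : Fin k → Fin n (the edge is {(i , f i) | i : Fin k}).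
-- G assigns true to exactly the edges.
PartiteGraph : ℕ → ℕ → Set
PartiteGraph k n = (Fin k → Fin n) → Bool

edgeCount : ∀ k n → PartiteGraph k n → ℕ
edgeCount zero n G with G (λ ())
... | true = 1
... | false = 0
edgeCount (suc k) n G = sumFin n (λ i → edgeCount k n (λ f → G (λ { zero → i ; (suc j) → f j })))
  where
  sumFin : ∀ m → (Fin m → ℕ) → ℕ
  sumFin zero g = 0
  sumFin (suc m) g = g zero + sumFin m (λ x → g (suc x))

-- Guest hypergraph: a k-partite k-uniform hypergraph on vertex set Fin h,
-- given with a witnessing partition into k parts and a list of edges; each
-- edge is given as its vertex in each part.
record KPartite (k h : ℕ) : Set where
  field
    part  : Fin h → Fin k
    edges : List (Fin k → Fin h)
    partOK : All (λ e → ∀ i → part (e i) ≡ i) edges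
open KPartite public

anyFin : ∀ m → (Fin m → Bool) → Bool
anyFin zero g = false
anyFin (suc m) g = g zero ∨ anyFin m (λ x → g (suc x))

adj : ∀ {k h} → KPartite k h → Fin h → Fin h → Bool
adj {k} H u v = not ⌊ u ≟ v ⌋ ∧
  any (λ e → anyFin k (λ i → anyFin k (λ j → ⌊ e i ≟ u ⌋ ∧ ⌊ e j ≟ v ⌋))) (edges H)

degIn : ∀ {k h} → KPartite k h → Subset h → Fin h → ℕ
degIn H S v = ∣ tabulate (λ u → ⌊ u ∈? S ⌋ ∧ adj H u v) ∣

-- every (nonempty) subgraph of the 1-skeleton has a vertex of degree ≤ d
-- (it suffices to consider induced subgraphs)
Degenerate : ∀ {k h} → KPartite k h → ℕ → Set
Degenerate {h = h} H d = (S : Subset h) → Nonempty S → ∃[ v ] (v ∈ S × degIn H S v ≤ d)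

SkelDegeneracy : ∀ {k h} → KPartite k h → ℕ → Set
SkelDegeneracy H d = Degenerate H d × (∀ d' → Degenerate H d' → d ≤ d')

-- G contains H (as a subhypergraph): an injective vertex map sending every
-- edge of H into (hence, by injectivity, onto) an edge of G.
Contains : ∀ {k n h} → PartiteGraph k n → KPartite k h → Set
Contains {k} {n} {h} G H =
  Σ (Fin h → Fin k × Fin n) λ φ → Injective _≡_ _≡_ φ ×
    All (λ e → ∃[ f ] (G f ≡ true × (∀ j → ∃[ i ] (φ (e j) ≡ (i , f i))))) (edges H)

⟦_⟧ : ℕ → ℚ
⟦ n ⟧ = + n / 1

{-# OPTIONS --safe #-}
module Submission where

-- The vertices of H are embedded greedily along a degeneracy order.  Let s = d + 1
-- and let T consist of s vertices in each part of G such that all edges across T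
-- are present; a fraction of at least p ^ (s ^ k) of all choices has this property.
-- Each u in H may go to those x for which every edge e of H through u remains
-- realisable: all k-tuples are edges of G that consist of x and, in each other part
-- j, of the image of e j (if already placed) or of an element of T j.  If the placed
-- neighbours of u are themselves compatible with T, then T (part u) lies in the
-- candidate set C.  So, averaging over T and over uniformly random images of the
-- neighbours, the moment (n / (|C| + 1)) ^ s is at most 1.  This is dependent random
-- choice.
--
-- A potential controls the embedding.  With w the cost n / (|C| + 1) of a placed
-- vertex, a vertex u contributes I times the expected s-th moment of its cost, where
-- I divides by 2 w for every placed neighbour.  If a vertex is sent to a uniformly
-- random candidate, then the division by 2 w compensates the loss of randomness in
-- its neighbours, and the loss of one vertex from other candidate sets multiplies
-- their contributions by 1 + O(w / n) only, whatever their sizes are.  Conversely,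
-- w is at most η Σ w' + β I w ^ s where w' runs over the costs of its neighbours and
-- η = 1 / 2d.  A suitable weighting of these quantities never increases when the
-- images are chosen well.  It is O(h) in the beginning, hence less than n, so no
-- candidate set becomes empty: that would cost n.

open import Defs
open import Algebra.Bundles using (CommutativeRing)
open import Data.Bool as Bool using (Bool; true; false; _∧_; _∨_; not; if_then_else_)
open import Data.Bool.ListAction using (all; any)
open import Data.Fin as Fin using (Fin; zero; suc; opposite)
import Data.Fin.Properties as Fin
open import Data.Fin.Properties using (any?)
open import Data.Fin.Subset using (Subset; ∣_∣; ⊤) renaming (_∈_ to _∈ˢ_; _-_ to _-ˢ_)
open import Data.Fin.Subset.Properties using (_∈?_; ∈⊤; nonempty?; ∣p∣≤n; x∈p⇒∣p-x∣<∣p∣; x∈p∧x≢y⇒x∈p-y; p─q⊆p)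
import Data.Integer as ℤ
import Data.Integer.Properties as ℤ
open import Data.List as List using (List; []; _∷_; _++_)
open import Data.List.Membership.Propositional using (_∈_)
open import Data.List.Membership.Propositional.Properties using (∈-++⁺ˡ; ∈-++⁺ʳ; ∈-++⁻; ∈-map⁺; ∈-map⁻)
open import Data.List.Relation.Unary.All as All using (All)
open import Data.List.Relation.Unary.Any using (here; there)
open import Data.Nat as ℕ using (ℕ; zero; suc; _^_) renaming (_≤_ to _≤ℕ_)
import Data.Nat.Properties as ℕ
open import Data.Product using (_×_; _,_; ∃-syntax; Σ-syntax; proj₁; proj₂)
open import Data.Rational using (ℚ; 0ℚ; ½; 1ℚ; _+_; _*_; _-_; -_; _≤_; _<_; 1/_; positive; nonNegative; toℚᵘ)
open import Data.Rational.Properties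
open import Data.Rational.Solver using (module +-*-Solver)
open import Data.Rational.Unnormalised as ℚᵘ using (mkℚᵘ)
import Data.Rational.Unnormalised.Properties as ℚᵘ
open import Data.Sum using (inj₁; inj₂)
open import Data.Vec as Vec using (Vec; []; _∷_; lookup; _[_]≔_; replicate; tabulate; toList)
open import Data.Vec.Properties using (lookup∘update; lookup∘update′; lookup∘tabulate)
open import Function using (_∘_)
open import Function.Definitions using (Injective)
open import Relation.Binary.PropositionalEquality hiding (J)
open import Relation.Nullary using (¬_; Dec; yes; no; contradiction; _×-dec_; ⌊_⌋)
open import Algebra.Properties.CommutativeSemiring.Exp (CommutativeRing.commutativeSemiring +-*-commutativeRing) using () renaming (_^_ to _^ʳ_; ^-distrib-* to ^ʳ-distrib-*; ^-assocʳ to ^ʳ-assocʳ)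
open import Algebra.Properties.Semiring.Sum (CommutativeRing.semiring +-*-commutativeRing) using (sum; ∑-distrib-+; ∑-comm; *-distribˡ-sum; sum-cong-≗)
open +-*-Solver using (solve; _:=_; _:+_; _:*_; _:-_; con)

-- Rational arithmetic, natural numbers as rationals, and inequalities between powers

-- An inequality is shown by exhibiting the difference `e`; what remains is a ring identity for the
-- solver.
≤-by : ∀ {a b} e → 0ℚ ≤ e → b ≡ a + e → a ≤ b
≤-by {a} e 0≤e refl = subst (_≤ a + e) (+-identityʳ a) (+-monoʳ-≤ a 0≤e)

p≤q⇒0≤q-p : ∀ {p q} → p ≤ q → 0ℚ ≤ q - p
p≤q⇒0≤q-p {p} {q} p≤q = subst (_≤ q - p) (+-inverseʳ p) (+-monoˡ-≤ (- p) p≤q)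

0≤+ : ∀ {p q} → 0ℚ ≤ p → 0ℚ ≤ q → 0ℚ ≤ p + q
0≤+ = +-mono-≤

*-monoˡ : ∀ {c p q} → 0ℚ ≤ c → p ≤ q → c * p ≤ c * q
*-monoˡ {c} 0≤c = *-monoˡ-≤-nonNeg c {{nonNegative 0≤c}}

*-monoʳ : ∀ {c p q} → 0ℚ ≤ c → p ≤ q → p * c ≤ q * c
*-monoʳ {c} 0≤c = *-monoʳ-≤-nonNeg c {{nonNegative 0≤c}}

0≤* : ∀ {p q} → 0ℚ ≤ p → 0ℚ ≤ q → 0ℚ ≤ p * q
0≤* {p} {q} 0≤p 0≤q = subst (_≤ p * q) (*-zeroʳ p) (*-monoˡ 0≤p 0≤q)

*-mono : ∀ {p q r s} → 0ℚ ≤ p → p ≤ q → 0ℚ ≤ r → r ≤ s → p * r ≤ q * s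
*-mono {p} {q} {r} {s} 0≤p p≤q 0≤r r≤s =
  ≤-trans (*-monoˡ 0≤p r≤s)
          (subst₂ _≤_ (*-comm s p) (*-comm s q) (*-monoˡ (≤-trans 0≤r r≤s) p≤q))

*-cancelˡ : ∀ {c p q} → 0ℚ < c → c * p ≤ c * q → p ≤ q
*-cancelˡ {c} 0<c = *-cancelˡ-≤-pos c {{positive 0<c}}

0<* : ∀ {p q} → 0ℚ < p → 0ℚ < q → 0ℚ < p * q
0<* {p} {q} 0<p 0<q = positive⁻¹ (p * q) {{pos*pos⇒pos p {{positive 0<p}} q {{positive 0<q}}}}

0≤^ : ∀ {p} n → 0ℚ ≤ p → 0ℚ ≤ p ^ʳ n
0≤^ zero    0≤p = <⇒≤ (positive⁻¹ 1ℚ)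
0≤^ (suc n) 0≤p = 0≤* 0≤p (0≤^ n 0≤p)

0<^ : ∀ {p} n → 0ℚ < p → 0ℚ < p ^ʳ n
0<^ zero    0<p = positive⁻¹ 1ℚ
0<^ (suc n) 0<p = 0<* 0<p (0<^ n 0<p)

^-monoˡ : ∀ {p q} n → 0ℚ ≤ p → p ≤ q → p ^ʳ n ≤ q ^ʳ n
^-monoˡ zero    0≤p p≤q = ≤-refl
^-monoˡ (suc n) 0≤p p≤q = *-mono 0≤p p≤q (0≤^ n 0≤p) (^-monoˡ n 0≤p p≤q)

0≤1 : 0ℚ ≤ 1ℚ
0≤1 = nonNegative⁻¹ 1ℚ

^-monoʳ : ∀ {p m n} → 1ℚ ≤ p → m ℕ.≤ n → p ^ʳ m ≤ p ^ʳ n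
^-monoʳ {p} {n = zero}  1≤p ℕ.z≤n = ≤-refl
^-monoʳ {p} {n = suc n} 1≤p ℕ.z≤n =
  *-mono {1ℚ} {p} {1ℚ} 0≤1 1≤p 0≤1 (^-monoʳ {p} 1≤p (ℕ.z≤n {n}))
^-monoʳ {p} 1≤p (ℕ.s≤s m≤n) = *-monoˡ (≤-trans 0≤1 1≤p) (^-monoʳ 1≤p m≤n)

1^ : ∀ n → 1ℚ ^ʳ n ≡ 1ℚ
1^ zero    = refl
1^ (suc n) = trans (*-identityˡ _) (1^ n)

private
  toℚᵘ-⟦⟧ : ∀ n → toℚᵘ ⟦ n ⟧ ℚᵘ.≃ mkℚᵘ (ℤ.+ n) 0
  toℚᵘ-⟦⟧ n = toℚᵘ-fromℚᵘ (mkℚᵘ (ℤ.+ n) 0)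

⟦⟧-+ : ∀ m n → ⟦ m ℕ.+ n ⟧ ≡ ⟦ m ⟧ + ⟦ n ⟧
⟦⟧-+ m n = toℚᵘ-injective (ℚᵘ.≃-trans (toℚᵘ-⟦⟧ (m ℕ.+ n)) (ℚᵘ.≃-trans (ℚᵘ.*≡* e)
  (ℚᵘ.≃-sym (ℚᵘ.≃-trans (toℚᵘ-homo-+ ⟦ m ⟧ ⟦ n ⟧) (ℚᵘ.+-cong (toℚᵘ-⟦⟧ m) (toℚᵘ-⟦⟧ n))))))
  where
  e : ℤ.+ (m ℕ.+ n) ℤ.* ℤ.1ℤ ≡ (ℤ.+ m ℤ.* ℤ.1ℤ ℤ.+ ℤ.+ n ℤ.* ℤ.1ℤ) ℤ.* ℤ.1ℤ
  e = cong (ℤ._* ℤ.1ℤ) (sym (cong₂ ℤ._+_ (ℤ.*-identityʳ (ℤ.+ m)) (ℤ.*-identityʳ (ℤ.+ n))))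

⟦suc⟧ : ∀ n → ⟦ suc n ⟧ ≡ 1ℚ + ⟦ n ⟧
⟦suc⟧ = ⟦⟧-+ 1

0≤⟦⟧ : ∀ n → 0ℚ ≤ ⟦ n ⟧
0≤⟦⟧ zero    = ≤-refl
0≤⟦⟧ (suc n) = subst (0ℚ ≤_) (sym (⟦suc⟧ n)) (0≤+ 0≤1 (0≤⟦⟧ n))

0<⟦suc⟧ : ∀ n → 0ℚ < ⟦ suc n ⟧
0<⟦suc⟧ n = subst (0ℚ <_) (sym (⟦suc⟧ n)) (+-mono-<-≤ (positive⁻¹ 1ℚ) (0≤⟦⟧ n))

⟦⟧-mono : ∀ {m n} → m ℕ.≤ n → ⟦ m ⟧ ≤ ⟦ n ⟧
⟦⟧-mono {m} {n} m≤n = ≤-by ⟦ n ℕ.∸ m ⟧ (0≤⟦⟧ (n ℕ.∸ m))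
  (trans (cong ⟦_⟧ (sym (ℕ.m+[n∸m]≡n m≤n))) (⟦⟧-+ m (n ℕ.∸ m)))

⟦⟧-* : ∀ m n → ⟦ m ℕ.* n ⟧ ≡ ⟦ m ⟧ * ⟦ n ⟧
⟦⟧-* zero    n = sym (*-zeroˡ ⟦ n ⟧)
⟦⟧-* (suc m) n = begin
  ⟦ n ℕ.+ m ℕ.* n ⟧        ≡⟨ ⟦⟧-+ n (m ℕ.* n) ⟩
  ⟦ n ⟧ + ⟦ m ℕ.* n ⟧      ≡⟨ cong (⟦ n ⟧ +_) (⟦⟧-* m n) ⟩
  ⟦ n ⟧ + ⟦ m ⟧ * ⟦ n ⟧    ≡⟨ solve 2 (λ a b → b :+ a :* b := (con 1ℚ :+ a) :* b) refl ⟦ m ⟧ ⟦ n ⟧ ⟩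
  (1ℚ + ⟦ m ⟧) * ⟦ n ⟧     ≡⟨ cong (_* ⟦ n ⟧) (⟦suc⟧ m) ⟨
  ⟦ suc m ⟧ * ⟦ n ⟧        ∎
  where open ≡-Reasoning

⟦⟧-^ : ∀ n k → ⟦ n ℕ.^ k ⟧ ≡ ⟦ n ⟧ ^ʳ k
⟦⟧-^ n zero    = refl
⟦⟧-^ n (suc k) = trans (⟦⟧-* n (n ℕ.^ k)) (cong (⟦ n ⟧ *_) (⟦⟧-^ n k))

reciprocal : ∀ {p} → 0ℚ < p → ∃[ q ] (0ℚ < q × q * p ≡ 1ℚ)
reciprocal {p} 0<p = 1/ p , positive⁻¹ (1/ p) {{1/pos⇒pos p}} , *-inverseˡ p
  where
  instance
    p-pos = positive 0<p
    p-nz  = pos⇒nonZero p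

-- This is 1 / (m + 1); the shift makes it total.
recip : ℕ → ℚ
recip m = proj₁ (reciprocal (0<⟦suc⟧ m))

0<recip : ∀ m → 0ℚ < recip m
0<recip m = proj₁ (proj₂ (reciprocal (0<⟦suc⟧ m)))

0≤recip : ∀ m → 0ℚ ≤ recip m
0≤recip m = <⇒≤ (0<recip m)

recip-inverse : ∀ m → recip m * ⟦ suc m ⟧ ≡ 1ℚ
recip-inverse m = proj₂ (proj₂ (reciprocal (0<⟦suc⟧ m)))

-- From the tangent line at y: the difference of the two sides grows with n
-- by (n + 1) yⁿ (x - y)².
tangent-bound : ∀ {x y} n → 0ℚ ≤ x → 0ℚ ≤ y →
  ⟦ suc n ⟧ * (y ^ʳ n * x) ≤ x ^ʳ suc n + ⟦ n ⟧ * y ^ʳ suc n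
tangent-bound {x} {y} zero 0≤x 0≤y =
  ≤-reflexive (solve 2 (λ x y → con 1ℚ :* (con 1ℚ :* x) := x :* con 1ℚ :+ con 0ℚ :* (y :* con 1ℚ)) refl x y)
tangent-bound {x} {y} (suc n) 0≤x 0≤y = ≤-by
  (x * (x ^ʳ suc n + ⟦ n ⟧ * y ^ʳ suc n - ⟦ suc n ⟧ * (y ^ʳ n * x)) + ⟦ suc n ⟧ * y ^ʳ n * ((x - y) * (x - y)))
  (0≤+ (0≤* 0≤x (p≤q⇒0≤q-p (tangent-bound n 0≤x 0≤y)))
       (0≤* (0≤* (0≤⟦⟧ (suc n)) (0≤^ n 0≤y)) 0≤square))
  (begin
    x ^ʳ suc (suc n) + ⟦ suc n ⟧ * y ^ʳ suc (suc n)
      ≡⟨ cong (λ c → x ^ʳ suc (suc n) + c * y ^ʳ suc (suc n)) (⟦suc⟧ n) ⟩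
    x * (x * x ^ʳ n) + (1ℚ + ⟦ n ⟧) * (y * (y * y ^ʳ n))
      ≡⟨ solve 5 (λ x y a b m →
           x :* (x :* a) :+ (con 1ℚ :+ m) :* (y :* (y :* b))
           := (con 1ℚ :+ (con 1ℚ :+ m)) :* (y :* b :* x)
              :+ (x :* (x :* a :+ m :* (y :* b) :- (con 1ℚ :+ m) :* (b :* x)) :+ (con 1ℚ :+ m) :* b :* ((x :- y) :* (x :- y))))
           refl x y (x ^ʳ n) (y ^ʳ n) ⟦ n ⟧ ⟩
    (1ℚ + (1ℚ + ⟦ n ⟧)) * (y ^ʳ suc n * x)
      + (x * (x ^ʳ suc n + ⟦ n ⟧ * y ^ʳ suc n - (1ℚ + ⟦ n ⟧) * (y ^ʳ n * x)) + (1ℚ + ⟦ n ⟧) * y ^ʳ n * ((x - y) * (x - y)))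
      ≡⟨ cong₂ (λ c c′ → c * (y ^ʳ suc n * x)
           + (x * (x ^ʳ suc n + ⟦ n ⟧ * y ^ʳ suc n - c′ * (y ^ʳ n * x)) + c′ * y ^ʳ n * ((x - y) * (x - y))))
           (trans (cong (1ℚ +_) (sym (⟦suc⟧ n))) (sym (⟦suc⟧ (suc n)))) (sym (⟦suc⟧ n)) ⟩
    ⟦ suc (suc n) ⟧ * (y ^ʳ suc n * x)
      + (x * (x ^ʳ suc n + ⟦ n ⟧ * y ^ʳ suc n - ⟦ suc n ⟧ * (y ^ʳ n * x)) + ⟦ suc n ⟧ * y ^ʳ n * ((x - y) * (x - y))) ∎)
  where
  open ≡-Reasoning
  0≤square : 0ℚ ≤ (x - y) * (x - y)
  0≤square with ≤-total x y
  ... | inj₁ x≤y = subst (0ℚ ≤_) (solve 2 (λ x y → (y :- x) :* (y :- x) := (x :- y) :* (x :- y)) refl x y)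
                     (0≤* (p≤q⇒0≤q-p x≤y) (p≤q⇒0≤q-p x≤y))
  ... | inj₂ y≤x = 0≤* (p≤q⇒0≤q-p y≤x) (p≤q⇒0≤q-p y≤x)

-- Induction with t = 3ˢ: (1 + y)(1 + t y) ≤ 1 + 3 t y, because y² ≤ y and 1 ≤ t.
bernoulli-upper : ∀ {y} s → 0ℚ ≤ y → y ≤ 1ℚ → (1ℚ + y) ^ʳ s ≤ 1ℚ + ⟦ 3 ⟧ ^ʳ s * y
bernoulli-upper {y} zero 0≤y y≤1 = ≤-by (1ℚ * y) (0≤* 0≤1 0≤y) refl
bernoulli-upper {y} (suc s) 0≤y y≤1 = ≤-trans
  (*-monoˡ (0≤+ 0≤1 0≤y) (bernoulli-upper s 0≤y y≤1))
  (≤-by (t * y * (1ℚ - y) + (t - 1ℚ) * y)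
    (0≤+ (0≤* (0≤* (≤-trans 0≤1 1≤t) 0≤y) (p≤q⇒0≤q-p y≤1)) (0≤* (p≤q⇒0≤q-p 1≤t) 0≤y))
    (solve 2 (λ t y → con 1ℚ :+ con ⟦ 3 ⟧ :* t :* y
       := (con 1ℚ :+ y) :* (con 1ℚ :+ t :* y) :+ (t :* y :* (con 1ℚ :- y) :+ (t :- con 1ℚ) :* y)) refl t y))
  where
  t = ⟦ 3 ⟧ ^ʳ s
  1≤t : 1ℚ ≤ t
  1≤t = subst (_≤ t) (1^ s) (^-monoˡ s 0≤1 (⟦⟧-mono {1} {3} (ℕ.s≤s ℕ.z≤n)))

-- Indicators, cardinalities and sums over `Fin n`

𝟙 : Bool → ℚ
𝟙 true  = 1ℚ
𝟙 false = 0ℚ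

0≤𝟙 : ∀ b → 0ℚ ≤ 𝟙 b
0≤𝟙 true  = 0≤1
0≤𝟙 false = ≤-refl

𝟙≤1 : ∀ b → 𝟙 b ≤ 1ℚ
𝟙≤1 true  = ≤-refl
𝟙≤1 false = 0≤1

𝟙-∧ : ∀ a b → 𝟙 (a ∧ b) ≡ 𝟙 a * 𝟙 b
𝟙-∧ true  b = sym (*-identityˡ (𝟙 b))
𝟙-∧ false b = sym (*-zeroˡ (𝟙 b))

𝟙-mono : ∀ {a b} → (a ≡ true → b ≡ true) → 𝟙 a ≤ 𝟙 b
𝟙-mono {true}  f rewrite f refl = ≤-refl
𝟙-mono {false} {b} f = 0≤𝟙 b

card : ∀ {n} → (Fin n → Bool) → ℕ
card {zero}  C = 0
card {suc n} C with C zero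
... | true  = suc (card (λ i → C (suc i)))
... | false = card (λ i → C (suc i))

card-cong : ∀ {n} {C D : Fin n → Bool} → (∀ i → C i ≡ D i) → card C ≡ card D
card-cong {zero}  e = refl
card-cong {suc n} {C} {D} e with C zero | D zero | e zero
... | true  | .true  | refl = cong suc (card-cong (λ i → e (suc i)))
... | false | .false | refl = card-cong (λ i → e (suc i))

card-false : ∀ {n} {C : Fin n → Bool} → (∀ i → C i ≡ false) → card C ≡ 0
card-false {zero} e = refl
card-false {suc n} {C} e rewrite e zero = card-false (λ i → e (suc i))

card-≤n : ∀ {n} (C : Fin n → Bool) → card C ℕ.≤ n
card-≤n {zero}  C = ℕ.z≤n
card-≤n {suc n} C with C zero
... | true  = ℕ.s≤s (card-≤n (λ i → C (suc i)))
... | false = ℕ.m≤n⇒m≤1+n (card-≤n (λ i → C (suc i)))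

card-nonempty : ∀ {n} (C : Fin n → Bool) → card C ≢ 0 → ∃[ i ] C i ≡ true
card-nonempty {zero}  C C≢∅ = contradiction refl C≢∅
card-nonempty {suc n} C C≢∅ with C zero in C₀
... | true  = zero , C₀
... | false = let (i , Ci) = card-nonempty (λ i → C (suc i)) C≢∅ in suc i , Ci

sum-𝟙 : ∀ {n} (C : Fin n → Bool) → sum (λ i → 𝟙 (C i)) ≡ ⟦ card C ⟧
sum-𝟙 {zero}  C = refl
sum-𝟙 {suc n} C with C zero
... | true  = trans (cong (1ℚ +_) (sum-𝟙 (λ i → C (suc i)))) (sym (⟦suc⟧ (card (λ i → C (suc i)))))
... | false = trans (+-identityˡ (sum (λ i → 𝟙 (C (suc i))))) (sum-𝟙 (λ i → C (suc i)))

sum-mono : ∀ {n} {f g : Fin n → ℚ} → (∀ i → f i ≤ g i) → sum f ≤ sum g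
sum-mono {zero}  f≤g = ≤-refl
sum-mono {suc n} f≤g = +-mono-≤ (f≤g zero) (sum-mono (λ i → f≤g (suc i)))

0≤sum : ∀ {n} {f : Fin n → ℚ} → (∀ i → 0ℚ ≤ f i) → 0ℚ ≤ sum f
0≤sum {zero}  0≤f = ≤-refl
0≤sum {suc n} 0≤f = 0≤+ (0≤f zero) (0≤sum (λ i → 0≤f (suc i)))

sum-const : ∀ n c → sum {n} (λ _ → c) ≡ ⟦ n ⟧ * c
sum-const zero    c = sym (*-zeroˡ c)
sum-const (suc n) c = begin
  c + sum {n} (λ _ → c)  ≡⟨ cong (c +_) (sum-const n c) ⟩
  c + ⟦ n ⟧ * c          ≡⟨ solve 2 (λ c m → c :+ m :* c := (con 1ℚ :+ m) :* c) refl c ⟦ n ⟧ ⟩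
  (1ℚ + ⟦ n ⟧) * c       ≡⟨ cong (_* c) (⟦suc⟧ n) ⟨
  ⟦ suc n ⟧ * c          ∎
  where open ≡-Reasoning

≤⇒≯ : ∀ {p q} → p ≤ q → ¬ q < p
≤⇒≯ p≤q q<p = <-irrefl refl (≤-<-trans p≤q q<p)

sum-mono-< : ∀ {n} {f g : Fin n → ℚ} → (∀ i → f i ≤ g i) → ∀ i → f i < g i → sum f < sum g
sum-mono-< {suc n} f≤g zero    f<g = +-mono-<-≤ f<g (sum-mono (λ i → f≤g (suc i)))
sum-mono-< {suc n} f≤g (suc i) f<g = +-mono-≤-< (f≤g zero) (sum-mono-< (λ i → f≤g (suc i)) i f<g)

sum-attained : ∀ {n} {f g : Fin (suc n) → ℚ} → sum f ≤ sum g → ∃[ i ] f i ≤ g i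
sum-attained {n} {f} {g} Σf≤Σg = decide (any? (λ i → f i ≤? g i))
  where
  decide : Dec (∃[ i ] f i ≤ g i) → ∃[ i ] f i ≤ g i
  decide (yes p) = p
  decide (no ¬p) = contradiction (sum-mono-< (λ i → <⇒≤ (g<f i)) zero (g<f zero)) (≤⇒≯ Σf≤Σg)
    where
    g<f : ∀ i → g i < f i
    g<f i = ≰⇒> (λ f≤g → ¬p (i , f≤g))

-- If `f` exceeded `c` at every candidate, the sum would exceed |C| c, strictly so because `C` has
-- an element.
weighted-attained : ∀ {n} (C : Fin n → Bool) (f : Fin n → ℚ) c → card C ≢ 0 →
  sum (λ i → 𝟙 (C i) * f i) ≤ ⟦ card C ⟧ * c → ∃[ i ] (C i ≡ true × f i ≤ c)
weighted-attained {n} C f c C≢∅ Σf≤ = decide (any? (λ i → (C i Bool.≟ true) ×-dec (f i ≤? c)))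
  where
  Σc : ⟦ card C ⟧ * c ≡ sum (λ i → 𝟙 (C i) * c)
  Σc = begin
    ⟦ card C ⟧ * c              ≡⟨ *-comm ⟦ card C ⟧ c ⟩
    c * ⟦ card C ⟧              ≡⟨ cong (c *_) (sum-𝟙 C) ⟨
    c * sum (λ i → 𝟙 (C i))     ≡⟨ *-distribˡ-sum c (λ i → 𝟙 (C i)) ⟩
    sum (λ i → c * 𝟙 (C i))     ≡⟨ sum-cong-≗ (λ i → *-comm c (𝟙 (C i))) ⟩
    sum (λ i → 𝟙 (C i) * c)     ∎
    where open ≡-Reasoning
  decide : Dec (∃[ i ] (C i ≡ true × f i ≤ c)) → ∃[ i ] (C i ≡ true × f i ≤ c)
  decide (yes p) = p
  decide (no ¬p) = contradiction (sum-mono-< below i below-i) (≤⇒≯ (subst (sum (λ i → 𝟙 (C i) * f i) ≤_) Σc Σf≤))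
    where
    c<f : ∀ i → C i ≡ true → c < f i
    c<f i Ci = ≰⇒> (λ fi≤c → ¬p (i , Ci , fi≤c))
    below : ∀ i → 𝟙 (C i) * c ≤ 𝟙 (C i) * f i
    below i with C i in Ci
    ... | true  = *-monoˡ 0≤1 (<⇒≤ (c<f i Ci))
    ... | false = ≤-reflexive (trans (*-zeroˡ c) (sym (*-zeroˡ (f i))))
    i = proj₁ (card-nonempty C C≢∅)
    Ci = proj₂ (card-nonempty C C≢∅)
    below-i : 𝟙 (C i) * c < 𝟙 (C i) * f i
    below-i rewrite Ci = subst₂ _<_ (sym (*-identityˡ c)) (sym (*-identityˡ (f i))) (c<f i Ci)

-- Means over finite sets

-- Monotonicity yields `ext`, which takes the place of function extensionality under a mean.
record Linear {A : Set} (L : (A → ℚ) → ℚ) : Set where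
  field
    mono : ∀ {f g} → (∀ a → f a ≤ g a) → L f ≤ L g
    +-homo : ∀ f g → L (λ a → f a + g a) ≡ L f + L g
    *-homo : ∀ c f → L (λ a → c * f a) ≡ c * L f

  ext : ∀ {f g} → (∀ a → f a ≡ g a) → L f ≡ L g
  ext e = ≤-antisym (mono (λ a → ≤-reflexive (e a))) (mono (λ a → ≤-reflexive (sym (e a))))

  sum-homo : ∀ {n} (f : Fin n → A → ℚ) → L (λ a → sum (λ i → f i a)) ≡ sum (λ i → L (f i))
  sum-homo {zero} f = begin
    L (λ _ → 0ℚ)        ≡⟨ ext (λ _ → *-zeroˡ 0ℚ) ⟨
    L (λ _ → 0ℚ * 0ℚ)   ≡⟨ *-homo 0ℚ (λ _ → 0ℚ) ⟩
    0ℚ * L (λ _ → 0ℚ)   ≡⟨ *-zeroˡ (L (λ _ → 0ℚ)) ⟩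
    0ℚ                  ∎
    where open ≡-Reasoning
  sum-homo {suc n} f = trans (+-homo (f zero) _) (cong (L (f zero) +_) (sum-homo (λ i → f (suc i))))

-- An expectation, given by the properties in use: `swap` is Fubini's theorem and `attained` is the
-- first moment method.
record Mean (A : Set) : Set₁ where
  field
    E : (A → ℚ) → ℚ
    linear : Linear E
    const : ∀ c → E (λ _ → c) ≡ c
    swap : ∀ {B : Set} {L : (B → ℚ) → ℚ} → Linear L → ∀ (f : A → B → ℚ) → E (λ a → L (f a)) ≡ L (λ b → E (λ a → f a b))
    attained : ∀ {f g} → E f ≤ E g → ∃[ a ] f a ≤ g a
  open Linear linear public

  0≤E : ∀ {f} → (∀ a → 0ℚ ≤ f a) → 0ℚ ≤ E f
  0≤E {f} 0≤f = subst (_≤ E f) (const 0ℚ) (mono 0≤f)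

  -- Average the tangent bound at y = E f: its left side becomes (n + 1) yⁿ⁺¹, of which n yⁿ⁺¹
  -- cancels.
  jensen : ∀ {f} n → (∀ a → 0ℚ ≤ f a) → E f ^ʳ n ≤ E (λ a → f a ^ʳ n)
  jensen {f} zero 0≤f = ≤-reflexive (sym (const 1ℚ))
  jensen {f} (suc n) 0≤f = ≤-by (E (λ a → f a ^ʳ suc n) + ⟦ n ⟧ * y ^ʳ suc n - ⟦ suc n ⟧ * (y ^ʳ n * y))
    (p≤q⇒0≤q-p (subst₂ _≤_
      (trans (*-homo ⟦ suc n ⟧ _) (cong (⟦ suc n ⟧ *_) (*-homo (y ^ʳ n) f)))
      (trans (+-homo _ _) (cong (E (λ a → f a ^ʳ suc n) +_) (const _)))
      (mono (λ a → tangent-bound n (0≤f a) (0≤E 0≤f)))))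
    (trans (solve 4 (λ e y p m → e := y :* p :+ (e :+ m :* (y :* p) :- (con 1ℚ :+ m) :* (p :* y))) refl
             (E (λ a → f a ^ʳ suc n)) y (y ^ʳ n) ⟦ n ⟧)
           (cong (λ c → y ^ʳ suc n + (E (λ a → f a ^ʳ suc n) + ⟦ n ⟧ * y ^ʳ suc n - c * (y ^ʳ n * y))) (sym (⟦suc⟧ n))))
    where y = E f

module _ (m : ℕ) where
  private
    ν = recip m
    n = suc m

    ν-sum-linear : Linear (λ f → ν * sum {n} f)
    ν-sum-linear = record
      { mono   = λ f≤g → *-monoˡ (0≤recip m) (sum-mono f≤g)
      ; +-homo = λ f g → trans (cong (ν *_) (∑-distrib-+ f g)) (*-distribˡ-+ ν (sum f) (sum g))
      ; *-homo = λ c f → trans (cong (ν *_) (sym (*-distribˡ-sum c f)))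
                           (solve 3 (λ ν c s → ν :* (c :* s) := c :* (ν :* s)) refl ν c (sum f))
      }

  uniform : Mean (Fin (suc m))
  uniform = record
    { E = λ f → ν * sum f
    ; linear = ν-sum-linear
    ; const = λ c → trans (cong (ν *_) (sum-const n c)) (trans (sym (*-assoc ν ⟦ n ⟧ c))
                      (trans (cong (_* c) (recip-inverse m)) (*-identityˡ c)))
    ; swap = λ {_} {L} lin f → trans (cong (ν *_) (sym (Linear.sum-homo lin f))) (sym (Linear.*-homo lin ν _))
    ; attained = λ {f} {g} Ef≤Eg → sum-attained (*-cancelˡ (0<recip m) Ef≤Eg)
    }

module _ {A : Set} (M : Mean A) where
  open Mean M

  vector : ∀ r → Mean (Vec A r)
  vector zero = record
    { E = λ f → f []
    ; linear = record { mono = λ f≤g → f≤g [] ; +-homo = λ _ _ → refl ; *-homo = λ _ _ → refl }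
    ; const = λ _ → refl
    ; swap = λ _ _ → refl
    ; attained = λ f≤g → [] , f≤g
    }
  vector (suc r) = record
    { E = λ f → E (λ a → V.E (λ v → f (a ∷ v)))
    ; linear = record
      { mono   = λ f≤g → mono (λ a → V.mono (λ v → f≤g (a ∷ v)))
      ; +-homo = λ f g → trans (ext (λ a → V.+-homo _ _)) (+-homo _ _)
      ; *-homo = λ c f → trans (ext (λ a → V.*-homo c _)) (*-homo c _)
      }
    ; const = λ c → trans (ext (λ a → V.const c)) (const c)
    ; swap = λ lin f → trans (ext (λ a → V.swap lin (λ v → f (a ∷ v)))) (swap lin _)
    ; attained = λ Ef≤Eg → let (a , p) = attained Ef≤Eg ; (v , q) = V.attained p in a ∷ v , q
    }
    where module V = Mean (vector r)

  -- The coordinates are independent, so one of them may be replaced by a fresh sample. For the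
  -- head, a mean over a dummy variable is inserted and the sampling of the tail is swapped
  -- outwards.
  resample : ∀ {r} (f : Vec A r → ℚ) i →
    Mean.E (vector r) f ≡ Mean.E (vector r) (λ v → E (λ a → f (v [ i ]≔ a)))
  resample {suc r} f zero = begin
    E (λ a → V.E (λ v → f (a ∷ v)))                ≡⟨ const _ ⟨
    E (λ _ → E (λ a → V.E (λ v → f (a ∷ v))))      ≡⟨ ext (λ _ → swap V.linear _) ⟩
    E (λ _ → V.E (λ v → E (λ a → f (a ∷ v))))      ∎
    where
    open ≡-Reasoning
    module V = Mean (vector r)
  resample {suc r} f (suc i) = ext (λ b → resample (λ v → f (b ∷ v)) i)

-- Removal of one candidate and its effect on the cost

_∖_ : ∀ {n} → (Fin n → Bool) → Fin n → Fin n → Bool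
(D ∖ x) y = D y ∧ not ⌊ x Fin.≟ y ⌋

∖-self : ∀ {n} (D : Fin n → Bool) {x y} → (D ∖ x) y ≡ true → D y ≡ true × x ≢ y
∖-self D {x} {y} e with D y | x Fin.≟ y
... | true | no x≢y = refl , x≢y

suc-≟ : ∀ {n} (x y : Fin n) → ⌊ suc x Fin.≟ suc y ⌋ ≡ ⌊ x Fin.≟ y ⌋
suc-≟ x y with x Fin.≟ y
... | yes _ = refl
... | no  _ = refl

card-∖ : ∀ {n} (D : Fin n → Bool) x → D x ≡ true → card D ≡ suc (card (D ∖ x))
card-∖ {suc n} D zero Dx rewrite Dx = cong suc (card-cong (λ i → sym (∧-true (D (suc i)))))
  where
  ∧-true : ∀ b → b ∧ true ≡ b
  ∧-true true  = refl
  ∧-true false = refl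
card-∖ {suc n} D (suc x) Dx with D zero
... | true  = cong suc (trans (card-∖ (λ i → D (suc i)) x Dx) (cong suc (card-cong (λ i → cong (λ b → D (suc i) ∧ not b) (sym (suc-≟ x i))))))
... | false = trans (card-∖ (λ i → D (suc i)) x Dx) (cong suc (card-cong (λ i → cong (λ b → D (suc i) ∧ not b) (sym (suc-≟ x i)))))

∖-absent : ∀ {n} (D : Fin n → Bool) x → D x ≡ false → ∀ y → (D ∖ x) y ≡ D y
∖-absent D x Dx y with x Fin.≟ y
... | no _ with D y
...   | true  = refl
...   | false = refl
∖-absent D x Dx .x | yes refl rewrite Dx = refl

-- The cost n / (m + 1) of choosing from m candidates; the shift by one keeps it finite.
weight : ℕ → ℕ → ℚ
weight n m = ⟦ n ⟧ * recip m

0≤weight : ∀ n m → 0ℚ ≤ weight n m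
0≤weight n m = 0≤* (0≤⟦⟧ n) (0≤recip m)

recip-1 : recip 0 ≡ 1ℚ
recip-1 = trans (sym (*-identityʳ (recip 0))) (recip-inverse 0)

-- Even if a whole part is available, m + 1 is at most twice its size.
½≤weight : ∀ {n m} → m ℕ.≤ suc n → ½ ≤ weight (suc n) m
½≤weight {n} {m} m≤n = *-cancelˡ (0<⟦suc⟧ m) (begin
  ⟦ suc m ⟧ * ½                      ≤⟨ *-monoʳ-≤-nonNeg ½ (⟦⟧-mono m+1≤2n) ⟩
  ⟦ suc n ℕ.+ suc n ⟧ * ½            ≡⟨ cong (_* ½) (⟦⟧-+ (suc n) (suc n)) ⟩
  (⟦ suc n ⟧ + ⟦ suc n ⟧) * ½        ≡⟨ solve 1 (λ a → (a :+ a) :* con ½ := a :* con 1ℚ) refl ⟦ suc n ⟧ ⟩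
  ⟦ suc n ⟧ * 1ℚ                     ≡⟨ cong (⟦ suc n ⟧ *_) (recip-inverse m) ⟨
  ⟦ suc n ⟧ * (recip m * ⟦ suc m ⟧)  ≡⟨ solve 3 (λ a b c → a :* (b :* c) := c :* (a :* b)) refl ⟦ suc n ⟧ (recip m) ⟦ suc m ⟧ ⟩
  ⟦ suc m ⟧ * (⟦ suc n ⟧ * recip m)  ∎)
  where
  open ≤-Reasoning
  m+1≤2n : suc m ℕ.≤ suc n ℕ.+ suc n
  m+1≤2n = ℕ.≤-trans (ℕ.s≤s m≤n) (ℕ.s≤s (ℕ.m≤n+m (suc n) n))

recip-≤1 : ∀ m → recip m ≤ 1ℚ
recip-≤1 m = subst (_≤ 1ℚ) (*-identityʳ (recip m)) (subst (recip m * 1ℚ ≤_) (recip-inverse m)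
  (*-monoˡ (0≤recip m) (⟦⟧-mono {1} {suc m} (ℕ.s≤s ℕ.z≤n))))

recip-step : ∀ m → recip m ≡ recip (suc m) * (1ℚ + recip m)
recip-step m = begin
  recip m                                              ≡⟨ *-identityʳ (recip m) ⟨
  recip m * 1ℚ                                         ≡⟨ cong (recip m *_) (recip-inverse (suc m)) ⟨
  recip m * (recip (suc m) * ⟦ suc (suc m) ⟧)          ≡⟨ cong (λ z → recip m * (recip (suc m) * z)) (⟦suc⟧ (suc m)) ⟩
  recip m * (recip (suc m) * (1ℚ + ⟦ suc m ⟧))         ≡⟨ solve 3 (λ a b c → a :* (b :* (con 1ℚ :+ c)) := b :* (a :* c :+ a)) refl (recip m) (recip (suc m)) ⟦ suc m ⟧ ⟩
  recip (suc m) * (recip m * ⟦ suc m ⟧ + recip m)      ≡⟨ cong (λ z → recip (suc m) * (z + recip m)) (recip-inverse m) ⟩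
  recip (suc m) * (1ℚ + recip m)                       ∎
  where open ≡-Reasoning

-- Here n / (m + 1) is n / (m + 2) times 1 + 1 / (m + 1), and `bernoulli-upper` applies to the
-- second factor.
weight-pred : ∀ n m s → weight n m ^ʳ s ≤ weight n (suc m) ^ʳ s + recip m * (⟦ 3 ⟧ ^ʳ s * weight n (suc m) ^ʳ s)
weight-pred n m s = begin
  weight n m ^ʳ s                                     ≡⟨ cong (_^ʳ s) (trans (cong (⟦ n ⟧ *_) (recip-step m)) (sym (*-assoc ⟦ n ⟧ (recip (suc m)) _))) ⟩
  (weight n (suc m) * (1ℚ + recip m)) ^ʳ s            ≡⟨ ^ʳ-distrib-* (weight n (suc m)) (1ℚ + recip m) s ⟩
  weight n (suc m) ^ʳ s * (1ℚ + recip m) ^ʳ s         ≤⟨ *-monoˡ (0≤^ s (0≤weight n (suc m))) (bernoulli-upper s (0≤recip m) (recip-≤1 m)) ⟩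
  weight n (suc m) ^ʳ s * (1ℚ + ⟦ 3 ⟧ ^ʳ s * recip m)
    ≡⟨ solve 3 (λ w t y → w :* (con 1ℚ :+ t :* y) := w :+ y :* (t :* w)) refl (weight n (suc m) ^ʳ s) (⟦ 3 ⟧ ^ʳ s) (recip m) ⟩
  weight n (suc m) ^ʳ s + recip m * (⟦ 3 ⟧ ^ʳ s * weight n (suc m) ^ʳ s) ∎
  where open ≤-Reasoning

0*p+q≡q : ∀ p q → 0ℚ * p + q ≡ q
0*p+q≡q = solve 2 (λ p q → con 0ℚ :* p :+ q := q) refl

-- The relative increase of the weight is at most 3ˢ / |D| and happens for |D| choices of x only.
weight-∖-sum : ∀ {n} N s (C D : Fin n → Bool) →
  sum (λ x → 𝟙 (C x) * weight N (card (D ∖ x)) ^ʳ s) ≤ (⟦ card C ⟧ + ⟦ 3 ⟧ ^ʳ s) * weight N (card D) ^ʳ s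
weight-∖-sum {n} N s C D = begin
  sum (λ x → 𝟙 (C x) * weight N (card (D ∖ x)) ^ʳ s)
    ≤⟨ sum-mono (λ x → pointwise x (C x) (D x) refl) ⟩
  sum (λ x → W * 𝟙 (C x) + ρ * (t * W) * 𝟙 (D x))
    ≡⟨ ∑-distrib-+ (λ x → W * 𝟙 (C x)) (λ x → ρ * (t * W) * 𝟙 (D x)) ⟩
  sum (λ x → W * 𝟙 (C x)) + sum (λ x → ρ * (t * W) * 𝟙 (D x))
    ≡⟨ cong₂ _+_ (scaled W C) (scaled (ρ * (t * W)) D) ⟩
  W * ⟦ card C ⟧ + ρ * (t * W) * ⟦ card D ⟧
    ≡⟨ solve 5 (λ W c ρ t r → W :* c :+ ρ :* (t :* W) :* r := W :* c :+ (t :* W) :* (ρ :* r)) refl W ⟦ card C ⟧ ρ t ⟦ card D ⟧ ⟩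
  W * ⟦ card C ⟧ + (t * W) * (ρ * ⟦ card D ⟧)
    ≤⟨ +-monoʳ-≤ (W * ⟦ card C ⟧) (*-monoˡ (0≤* 0≤t 0≤W) (ρr≤1 (card D))) ⟩
  W * ⟦ card C ⟧ + (t * W) * 1ℚ
    ≡⟨ solve 3 (λ W c t → W :* c :+ (t :* W) :* con 1ℚ := (c :+ t) :* W) refl W ⟦ card C ⟧ t ⟩
  (⟦ card C ⟧ + t) * W ∎
  where
  open ≤-Reasoning
  W = weight N (card D) ^ʳ s
  t = ⟦ 3 ⟧ ^ʳ s
  -- This is 1 / |D|, with the default 1 for empty `D`, where it meets only zero factors.
  ρ = recip (ℕ.pred (card D))
  0≤W : 0ℚ ≤ W
  0≤W = 0≤^ s (0≤weight N (card D))
  0≤t : 0ℚ ≤ t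
  0≤t = 0≤^ s (0≤⟦⟧ 3)
  scaled : ∀ c (A : Fin n → Bool) → sum (λ x → c * 𝟙 (A x)) ≡ c * ⟦ card A ⟧
  scaled c A = trans (sym (*-distribˡ-sum c (λ x → 𝟙 (A x)))) (cong (c *_) (sum-𝟙 A))
  ρr≤1 : ∀ r → recip (ℕ.pred r) * ⟦ r ⟧ ≤ 1ℚ
  ρr≤1 zero    = subst (_≤ 1ℚ) (sym (*-zeroʳ (recip 0))) 0≤1
  ρr≤1 (suc r) = ≤-reflexive (recip-inverse r)
  0≤extra : ∀ b → 0ℚ ≤ ρ * (t * W) * 𝟙 b
  0≤extra b = 0≤* (0≤* (0≤recip (ℕ.pred (card D))) (0≤* 0≤t 0≤W)) (0≤𝟙 b)
  pointwise : ∀ x b c → D x ≡ c → 𝟙 b * weight N (card (D ∖ x)) ^ʳ s ≤ W * 𝟙 b + ρ * (t * W) * 𝟙 c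
  pointwise x false c Dx = ≤-by (W * 0ℚ + ρ * (t * W) * 𝟙 c) (0≤+ (0≤* 0≤W ≤-refl) (0≤extra c))
    (sym (0*p+q≡q (weight N (card (D ∖ x)) ^ʳ s) (W * 0ℚ + ρ * (t * W) * 𝟙 c)))
  pointwise x true false Dx = ≤-by (ρ * (t * W) * 0ℚ) (0≤extra false)
    (cong (_+ ρ * (t * W) * 0ℚ) (trans (*-comm W 1ℚ)
      (cong (λ m → 1ℚ * weight N m ^ʳ s) (card-cong (λ y → sym (∖-absent D x Dx y))))))
  pointwise x true true Dx = subst (λ r → 1ℚ * weight N (card (D ∖ x)) ^ʳ s ≤
      weight N r ^ʳ s * 1ℚ + recip (ℕ.pred r) * (t * weight N r ^ʳ s) * 1ℚ) (sym (card-∖ D x Dx))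
    (subst₂ _≤_ (sym (*-identityˡ (weight N (card (D ∖ x)) ^ʳ s)))
                (solve 2 (λ a b → a :+ b := a :* con 1ℚ :+ b :* con 1ℚ) refl (weight N (suc (card (D ∖ x))) ^ʳ s) _)
                (weight-pred N (card (D ∖ x)) s))

-- Path-counting coefficients for the potential

-- coefficient η B u is the sum of ηˡ over all B-paths of length l starting at u.
coefficient : ℚ → ∀ {r} → (Fin r → Fin r → Bool) → Fin r → ℚ
coefficient η {suc r} B zero    = 1ℚ + η * sum (λ u → coefficient η (λ v w → B (suc v) (suc w)) u * 𝟙 (B zero (suc u)))
coefficient η {suc r} B (suc u) = coefficient η (λ v w → B (suc v) (suc w)) u

0≤coefficient : ∀ {η} → 0ℚ ≤ η → ∀ {r} (B : Fin r → Fin r → Bool) u → 0ℚ ≤ coefficient η B u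
0≤coefficient 0≤η B zero    = 0≤+ 0≤1 (0≤* 0≤η (0≤sum (λ u → 0≤* (0≤coefficient 0≤η _ u) (0≤𝟙 (B zero (suc u))))))
0≤coefficient 0≤η B (suc u) = 0≤coefficient 0≤η _ u

-- Sum the recursion over all vertices and count each edge of `B` at its later end. Edges that do
-- not go upwards are ignored by the recursion but counted on the right, hence only an inequality.
sum-coefficient : ∀ {η} → 0ℚ ≤ η → ∀ {r} (B : Fin r → Fin r → Bool) →
  sum (coefficient η B) ≤ ⟦ r ⟧ + η * sum (λ u → coefficient η B u * ⟦ card (λ v → B v u) ⟧)
sum-coefficient {η} 0≤η {zero}  B = ≤-by (η * 0ℚ) (≤-reflexive (sym (*-zeroʳ η))) refl
sum-coefficient {η} 0≤η {suc r} B = begin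
  1ℚ + η * b + sum c
    ≤⟨ +-monoʳ-≤ (1ℚ + η * b) (sum-coefficient 0≤η B′) ⟩
  1ℚ + η * b + (⟦ r ⟧ + η * sum (λ u → c u * deg′ u))
    ≡⟨ solve 4 (λ e b r s → con 1ℚ :+ e :* b :+ (r :+ e :* s) := (con 1ℚ :+ r) :+ e :* (b :+ s)) refl η b ⟦ r ⟧ (sum (λ u → c u * deg′ u)) ⟩
  (1ℚ + ⟦ r ⟧) + η * (b + sum (λ u → c u * deg′ u))
    ≡⟨ cong₂ (λ x y → x + η * y) (sym (⟦suc⟧ r))
         (trans (sym (∑-distrib-+ (λ u → c u * 𝟙 (B zero (suc u))) (λ u → c u * deg′ u))) (sum-cong-≗ deg-suc)) ⟩
  ⟦ suc r ⟧ + η * sum (λ u → c u * deg (suc u))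
    ≤⟨ +-monoʳ-≤ ⟦ suc r ⟧ (*-monoˡ 0≤η (≤-by c₀deg₀ (0≤* (0≤coefficient 0≤η B zero) (0≤⟦⟧ (card (λ v → B v zero))))
         (+-comm c₀deg₀ (sum (λ u → c u * deg (suc u)))))) ⟩
  ⟦ suc r ⟧ + η * sum (λ u → coefficient η B u * deg u) ∎
  where
  open ≤-Reasoning
  B′ = λ v w → B (suc v) (suc w)
  c = coefficient η B′
  b = sum (λ u → c u * 𝟙 (B zero (suc u)))
  deg = λ u → ⟦ card (λ v → B v u) ⟧
  deg′ = λ u → ⟦ card (λ v → B′ v u) ⟧
  c₀deg₀ = coefficient η B zero * deg zero
  deg-suc : ∀ u → c u * 𝟙 (B zero (suc u)) + c u * deg′ u ≡ c u * deg (suc u)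
  deg-suc u = trans (sym (*-distribˡ-+ (c u) _ _)) (cong (c u *_)
    (trans (cong (𝟙 (B zero (suc u)) +_) (sym (sum-𝟙 (λ v → B′ v u)))) (sum-𝟙 (λ v → B v (suc u)))))

-- With S the sum, in-degrees at most d and η d ≤ ½ give S ≤ r + S / 2.
sum-coefficient-≤2r : ∀ {η} d → 0ℚ ≤ η → η * ⟦ d ⟧ ≤ ½ → ∀ {r} (B : Fin r → Fin r → Bool) →
  (∀ u → card (λ v → B v u) ℕ.≤ d) → sum (coefficient η B) ≤ ⟦ r ⟧ + ⟦ r ⟧
sum-coefficient-≤2r {η} d 0≤η ηd≤½ {r} B deg≤d = ≤-by
  (Σ′ + Σ′ + (R - S + (R - S)))
  (0≤+ (0≤+ 0≤Σ′ 0≤Σ′) (0≤+ 0≤R-S 0≤R-S)) identity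
  where
  S = sum (coefficient η B)
  Q = η * sum (λ u → coefficient η B u * ⟦ card (λ v → B v u) ⟧)
  R = ⟦ r ⟧ + Q
  Σ′ = S * ½ - Q
  0≤R-S : 0ℚ ≤ R - S
  0≤R-S = p≤q⇒0≤q-p (sum-coefficient 0≤η B)
  Q≤ : Q ≤ S * ½
  Q≤ = begin
    η * sum (λ u → coefficient η B u * ⟦ card (λ v → B v u) ⟧)
      ≤⟨ *-monoˡ 0≤η (sum-mono (λ u → *-monoˡ (0≤coefficient 0≤η B u) (⟦⟧-mono (deg≤d u)))) ⟩
    η * sum (λ u → coefficient η B u * ⟦ d ⟧)
      ≡⟨ cong (η *_) (trans (sum-cong-≗ (λ u → *-comm (coefficient η B u) ⟦ d ⟧)) (sym (*-distribˡ-sum ⟦ d ⟧ (coefficient η B)))) ⟩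
    η * (⟦ d ⟧ * S)
      ≡⟨ solve 3 (λ e d s → e :* (d :* s) := s :* (e :* d)) refl η ⟦ d ⟧ S ⟩
    S * (η * ⟦ d ⟧)
      ≤⟨ *-monoˡ (0≤sum (0≤coefficient 0≤η B)) ηd≤½ ⟩
    S * ½ ∎
    where open ≤-Reasoning
  0≤Σ′ : 0ℚ ≤ Σ′
  0≤Σ′ = p≤q⇒0≤q-p Q≤
  identity : ⟦ r ⟧ + ⟦ r ⟧ ≡ S + (Σ′ + Σ′ + (R - S + (R - S)))
  identity = solve 3 (λ r s q → r :+ r := s :+ (s :* con ½ :- q :+ (s :* con ½ :- q) :+ (r :+ q :- s :+ (r :+ q :- s)))) refl ⟦ r ⟧ S Q

-- Stages of the greedy embedding and their expected costs

-- A stage of the greedy embedding: r vertices remain, each u is to be sent to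
-- a candidate in cand u q, where q lists the images of the remaining vertices,
-- of which only those of the v with B v u matter.
record Stage (k m r : ℕ) : Set where
  field
    part  : Fin r → Fin k
    B     : Fin r → Fin r → Bool
    cand  : Fin r → Vec (Fin (suc m)) r → Fin (suc m) → Bool
    -- An event outside of which the cost of u is set to 0. By `valid-cand` it occurs as soon as all
    -- earlier vertices sit at candidates.
    valid : Fin r → Vec (Fin (suc m)) r → Bool
    B-<     : ∀ v u → B v u ≡ true → v Fin.< u
    B-part  : ∀ v u → B v u ≡ true → part v ≢ part u
    cand-local  : ∀ u v q x → B v u ≡ false → ∀ y → cand u (q [ v ]≔ x) y ≡ cand u q y
    valid-local : ∀ u v q x → B v u ≡ false → valid u (q [ v ]≔ x) ≡ valid u q
    valid-cand  : ∀ u q → (∀ v → v Fin.< u → cand v q (lookup q v) ≡ true) → valid u q ≡ true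

module _ {k m : ℕ} where
  open Stage
  private
    n = suc m

  infix 5 _&_∖_
  -- Parts are disjoint, so an image is withdrawn only from the candidates of vertices in the same
  -- part, as told by the flag.
  _&_∖_ : Bool → (Fin n → Bool) → Fin n → Fin n → Bool
  true  & D ∖ x = D ∖ x
  false & D ∖ x = D

  &∖-≢ : ∀ b (D : Fin n → Bool) x y → b ≡ true → (b & D ∖ x) y ≡ true → x ≢ y
  &∖-≢ true D x y _ e = proj₂ (∖-self D e)

  &∖⇒ : ∀ b (D : Fin n → Bool) x y → (b & D ∖ x) y ≡ true → D y ≡ true
  &∖⇒ true  D x y e = proj₁ (∖-self D e)
  &∖⇒ false D x y e = e

  &∖-cong : ∀ b {D D′ : Fin n → Bool} x → (∀ y → D y ≡ D′ y) → ∀ y → (b & D ∖ x) y ≡ (b & D′ ∖ x) y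
  &∖-cong true  x e y = cong (_∧ _) (e y)
  &∖-cong false x e y = e y

  module _ {r : ℕ} (st : Stage k m (suc r)) where
    samePart : Fin r → Bool
    samePart u = ⌊ part st zero Fin.≟ part st (suc u) ⌋

    B-zero : ∀ v → B st v zero ≡ false
    B-zero v with B st v zero in e
    ... | false = refl
    ... | true  = contradiction (B-< st v zero e) λ ()

    samePart-≡ : ∀ u → part st zero ≡ part st (suc u) → samePart u ≡ true
    samePart-≡ u e with part st zero Fin.≟ part st (suc u)
    ... | yes _ = refl
    ... | no ¬e = contradiction e ¬e

    samePart-≢ : ∀ u → part st zero ≢ part st (suc u) → samePart u ≡ false
    samePart-≢ u ¬e with part st zero Fin.≟ part st (suc u)
    ... | yes e = contradiction e ¬e
    ... | no  _ = refl

    -- Vertex zero has no `B`-neighbours before it, so by `cand-local` the coordinates of `q` can be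
    -- exchanged one at a time.
    cand-zero : ∀ q q′ y → cand st zero q y ≡ cand st zero q′ y
    cand-zero (x ∷ q) (x′ ∷ q′) y = trans
      (sym (cand-local st zero zero (x ∷ q) x′ (B-zero zero) y))
      (go q q′ (λ p → cand st zero (x′ ∷ p) y) (λ p v a → cand-local st zero (suc v) (x′ ∷ p) a (B-zero (suc v)) y))
      where
      go : ∀ {l} (q q′ : Vec (Fin n) l) (f : Vec (Fin n) l → Bool) → (∀ p v a → f (p [ v ]≔ a) ≡ f p) → f q ≡ f q′
      go [] [] f e = refl
      go (a ∷ q) (a′ ∷ q′) f e = trans (sym (e (a ∷ q) zero a′))
        (go q q′ (λ p → f (a′ ∷ p)) (λ p v b → e (a′ ∷ p) (suc v) b))

    -- Vertex zero is fixed at `x`. That `x` is a candidate carries `valid-cand` over to the new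
    -- stage.
    next : ∀ x → (∀ q → cand st zero q x ≡ true) → Stage k m r
    next x x∈C = record
      { part  = λ u → part st (suc u)
      ; B     = λ v u → B st (suc v) (suc u)
      ; cand  = λ u q → samePart u & cand st (suc u) (x ∷ q) ∖ x
      ; valid = λ u q → valid st (suc u) (x ∷ q)
      ; B-<    = λ v u e → ℕ.s≤s⁻¹ (B-< st (suc v) (suc u) e)
      ; B-part = λ v u → B-part st (suc v) (suc u)
      ; cand-local  = λ u v q y e → &∖-cong (samePart u) x (cand-local st (suc u) (suc v) (x ∷ q) y e)
      ; valid-local = λ u v q → valid-local st (suc u) (suc v) (x ∷ q)
      ; valid-cand  = λ u q h → valid-cand st (suc u) (x ∷ q) λ
          { zero    _          → x∈C (x ∷ q)
          ; (suc v) (ℕ.s≤s v<u) → &∖⇒ (samePart v) _ x _ (h v v<u) }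
      }

  -- For a neighbour this is 1 / (2 w), where w = n / (c + 1) is the cost of the vertex just placed.
  discount : ℕ → Bool → ℚ
  discount c true  = ½ * ⟦ suc c ⟧ * recip m
  discount c false = 1ℚ

  0≤discount : ∀ c b → 0ℚ ≤ discount c b
  0≤discount c true  = 0≤* (0≤* (nonNegative⁻¹ ½) (0≤⟦⟧ (suc c))) (0≤recip m)
  0≤discount c false = 0≤1

  mean : ∀ r → Mean (Vec (Fin n) r)
  mean = vector (uniform m)

  module _ (s : ℕ) where
    cost : ∀ {r} → Stage k m r → Fin r → Vec (Fin n) r → ℚ
    cost st u q = 𝟙 (valid st u q) * weight n (card (cand st u q)) ^ʳ s

    0≤cost : ∀ {r} (st : Stage k m r) u q → 0ℚ ≤ cost st u q
    0≤cost st u q = 0≤* (0≤𝟙 (valid st u q)) (0≤^ s (0≤weight n (card (cand st u q))))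

    expected : ∀ {r} → Stage k m r → Fin r → ℚ
    expected {r} st u = Mean.E (mean r) (cost st u)

    0≤expected : ∀ {r} (st : Stage k m r) u → 0ℚ ≤ expected st u
    0≤expected {r} st u = Mean.0≤E (mean r) (0≤cost st u)

    expected-zero : ∀ {r} (st : Stage k m (suc r)) q₀ → expected st zero ≡ weight n (card (cand st zero q₀)) ^ʳ s
    expected-zero {r} st q₀ = trans
      (Mean.ext (mean (suc r)) {cost st zero} {λ _ → W} (λ q → trans
        (cong₂ (λ b c → 𝟙 b * weight n c ^ʳ s) (valid-cand st zero q (λ _ ())) (card-cong (cand-zero st q q₀)))
        (*-identityˡ W)))
      (Mean.const (mean (suc r)) W)
      where W = weight n (card (cand st zero q₀)) ^ʳ s

    module _ {r : ℕ} (st : Stage k m (suc r)) (C : Fin n → Bool) (C≗ : ∀ q x → cand st zero q x ≡ C x) where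
      -- The cost of u after vertex zero went to x, also defined for non-candidates x.
      cost′ : Fin r → Fin n → Vec (Fin n) r → ℚ
      cost′ u x q = 𝟙 (valid st (suc u) (x ∷ q)) * weight n (card (samePart st u & cand st (suc u) (x ∷ q) ∖ x)) ^ʳ s

      expected′ : Fin r → Fin n → ℚ
      expected′ u x = Mean.E (mean r) (cost′ u x)

      0≤expected′ : ∀ u x → 0ℚ ≤ expected′ u x
      0≤expected′ u x = Mean.0≤E (mean r) (λ q → 0≤* (0≤𝟙 (valid st (suc u) (x ∷ q)))
        (0≤^ s (0≤weight n (card (samePart st u & cand st (suc u) (x ∷ q) ∖ x)))))

      module _ (u : Fin r) where
        private
          c = ⟦ card C ⟧
          t = ⟦ 3 ⟧ ^ʳ s
          b = samePart st u

        -- The image is uniform on `C` instead of the whole part, which costs at most a factor n /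
        -- |C|. The discount (|C| + 1) / 2n pays for it, as |C| ≥ 1. Neighbours lie in different
        -- parts, so no candidate is withdrawn.
        expected-adjacent : B st zero (suc u) ≡ true → card C ≢ 0 →
          sum (λ x → 𝟙 (C x) * (½ * ⟦ suc (card C) ⟧ * recip m * expected′ u x)) ≤ c * expected st (suc u)
        expected-adjacent Bu C≢∅ = begin
          sum (λ x → 𝟙 (C x) * (j * recip m * expected′ u x))
            ≤⟨ sum-mono (λ x → ≤-trans (*-monoʳ (0≤* (0≤* 0≤j (0≤recip m)) (0≤expected′ u x)) (𝟙≤1 (C x)))
                 (≤-reflexive (trans (*-identityˡ (j * recip m * expected′ u x)) (cong (j * recip m *_) (same x))))) ⟩
          sum (λ x → j * recip m * F x)
            ≡⟨ *-distribˡ-sum (j * recip m) F ⟨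
          j * recip m * sum F
            ≡⟨ *-assoc j (recip m) (sum F) ⟩
          j * (recip m * sum F)
            ≤⟨ *-monoʳ (0≤expected st (suc u)) (j≤c (card C) C≢∅) ⟩
          c * (recip m * sum F) ∎
          where
          open ≤-Reasoning
          j = ½ * ⟦ suc (card C) ⟧
          0≤j : 0ℚ ≤ j
          0≤j = 0≤* (nonNegative⁻¹ ½) (0≤⟦⟧ (suc (card C)))
          F = λ x → Mean.E (mean r) (λ q → cost st (suc u) (x ∷ q))
          same : ∀ x → expected′ u x ≡ F x
          same x = Mean.ext (mean r) (λ q → cong (λ b′ → 𝟙 (valid st (suc u) (x ∷ q)) * weight n (card (b′ & cand st (suc u) (x ∷ q) ∖ x)) ^ʳ s) (samePart-≢ st u (B-part st zero (suc u) Bu)))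
          j≤c : ∀ l → l ≢ 0 → ½ * ⟦ suc l ⟧ ≤ ⟦ l ⟧
          j≤c zero    l≢0 = contradiction refl l≢0
          j≤c (suc l) _   = ≤-by (½ * ⟦ l ⟧) (0≤* (nonNegative⁻¹ ½) (0≤⟦⟧ l)) (begin-equality
            ⟦ suc l ⟧                               ≡⟨ ⟦suc⟧ l ⟩
            1ℚ + ⟦ l ⟧                              ≡⟨ solve 1 (λ l → con 1ℚ :+ l := con ½ :* (con 1ℚ :+ (con 1ℚ :+ l)) :+ con ½ :* l) refl ⟦ l ⟧ ⟩
            ½ * (1ℚ + (1ℚ + ⟦ l ⟧)) + ½ * ⟦ l ⟧     ≡⟨ cong (λ z → ½ * z + ½ * ⟦ l ⟧) (trans (cong (1ℚ +_) (sym (⟦suc⟧ l))) (sym (⟦suc⟧ (suc l)))) ⟩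
            ½ * ⟦ suc (suc l) ⟧ + ½ * ⟦ l ⟧ ∎)

        -- For fixed `q` the image `x` affects the cost only by being withdrawn, and the growth
        -- caused by this is already bounded on average over `C`.
        expected-nonadjacent : B st zero (suc u) ≡ false →
          sum (λ x → 𝟙 (C x) * expected′ u x) ≤ (c + t) * expected st (suc u)
        expected-nonadjacent Bu = begin
          sum (λ x → 𝟙 (C x) * expected′ u x)
            ≡⟨ sum-cong-≗ (λ x → sym (Mean.*-homo (mean r) (𝟙 (C x)) (cost′ u x))) ⟩
          sum (λ x → Mean.E (mean r) (λ q → 𝟙 (C x) * cost′ u x q))
            ≡⟨ Mean.sum-homo (mean r) (λ x q → 𝟙 (C x) * cost′ u x q) ⟨
          Mean.E (mean r) (λ q → sum (λ x → 𝟙 (C x) * cost′ u x q))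
            ≤⟨ Mean.mono (mean r) pointwise ⟩
          Mean.E (mean r) (λ q → (c + t) * F q)
            ≡⟨ Mean.*-homo (mean r) (c + t) F ⟩
          (c + t) * Mean.E (mean r) F
            ≡⟨ cong ((c + t) *_) (trans (sym (Mean.const (uniform m) _)) (Mean.ext (uniform m) (λ x → Mean.ext (mean r) (λ q → sym (independent x q))))) ⟩
          (c + t) * expected st (suc u) ∎
          where
          open ≤-Reasoning
          D = λ q → cand st (suc u) (zero ∷ q)
          V = λ q → valid st (suc u) (zero ∷ q)
          F = λ q → cost st (suc u) (zero ∷ q)
          cand≡ : ∀ x q y → cand st (suc u) (x ∷ q) y ≡ D q y
          cand≡ x q y = cand-local st (suc u) zero (zero ∷ q) x Bu y
          valid≡ : ∀ x q → valid st (suc u) (x ∷ q) ≡ V q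
          valid≡ x q = valid-local st (suc u) zero (zero ∷ q) x Bu
          independent : ∀ x q → cost st (suc u) (x ∷ q) ≡ F q
          independent x q = cong₂ (λ v l → 𝟙 v * weight n l ^ʳ s) (valid≡ x q) (card-cong (cand≡ x q))
          shrink : ∀ b q → sum (λ x → 𝟙 (C x) * weight n (card (b & D q ∖ x)) ^ʳ s) ≤ (c + t) * weight n (card (D q)) ^ʳ s
          shrink true  q = weight-∖-sum n s C (D q)
          shrink false q = begin
            sum (λ x → 𝟙 (C x) * W)  ≡⟨ sum-cong-≗ (λ x → *-comm (𝟙 (C x)) W) ⟩
            sum (λ x → W * 𝟙 (C x))  ≡⟨ *-distribˡ-sum W (λ x → 𝟙 (C x)) ⟨
            W * sum (λ x → 𝟙 (C x))  ≡⟨ cong (W *_) (sum-𝟙 C) ⟩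
            W * c                    ≤⟨ ≤-by (t * W) (0≤* (0≤^ s (0≤⟦⟧ 3)) (0≤^ s (0≤weight n (card (D q)))))
                                          (solve 3 (λ c t W → (c :+ t) :* W := W :* c :+ t :* W) refl c t W) ⟩
            (c + t) * W ∎
            where W = weight n (card (D q)) ^ʳ s
          pointwise : ∀ q → sum (λ x → 𝟙 (C x) * cost′ u x q) ≤ (c + t) * F q
          pointwise q = begin
            sum (λ x → 𝟙 (C x) * cost′ u x q)
              ≡⟨ sum-cong-≗ (λ x → trans
                   (cong₂ (λ v l → 𝟙 (C x) * (𝟙 v * weight n l ^ʳ s)) (valid≡ x q) (card-cong (&∖-cong b x (cand≡ x q))))
                   (solve 3 (λ a b c → a :* (b :* c) := b :* (a :* c)) refl (𝟙 (C x)) (𝟙 (V q)) (weight n (card (b & D q ∖ x)) ^ʳ s))) ⟩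
            sum (λ x → 𝟙 (V q) * (𝟙 (C x) * weight n (card (b & D q ∖ x)) ^ʳ s))
              ≡⟨ *-distribˡ-sum (𝟙 (V q)) (λ x → 𝟙 (C x) * weight n (card (b & D q ∖ x)) ^ʳ s) ⟨
            𝟙 (V q) * sum (λ x → 𝟙 (C x) * weight n (card (b & D q ∖ x)) ^ʳ s)
              ≤⟨ *-monoˡ (0≤𝟙 (V q)) (shrink b q) ⟩
            𝟙 (V q) * ((c + t) * weight n (card (D q)) ^ʳ s)
              ≡⟨ solve 3 (λ a b c → a :* (b :* c) := b :* (a :* c)) refl (𝟙 (V q)) (c + t) (weight n (card (D q)) ^ʳ s) ⟩
            (c + t) * F q ∎

        expected-step : card C ≢ 0 →
          sum (λ x → 𝟙 (C x) * (discount (card C) (B st zero (suc u)) * expected′ u x)) ≤ (c + t) * expected st (suc u)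
        expected-step C≢∅ = by-cases (B st zero (suc u)) refl
          where
          by-cases : ∀ a → B st zero (suc u) ≡ a →
            sum (λ x → 𝟙 (C x) * (discount (card C) a * expected′ u x)) ≤ (c + t) * expected st (suc u)
          by-cases true  e = ≤-trans (expected-adjacent e C≢∅)
            (*-monoʳ {_} {c} {c + t} (0≤expected st (suc u)) (≤-by t (0≤^ s (0≤⟦⟧ 3)) refl))
          by-cases false e = subst (_≤ (c + t) * expected st (suc u))
            (sum-cong-≗ (λ x → cong (𝟙 (C x) *_) (sym (*-identityˡ (expected′ u x))))) (expected-nonadjacent e)

-- The potential and the greedy step

card-head : ∀ {n} (C : Fin (suc n) → Bool) a → C zero ≡ a →
  card C ≡ (if a then suc (card (λ i → C (suc i))) else card (λ i → C (suc i)))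
card-head C a e with C zero
card-head C .true  refl | true  = refl
card-head C .false refl | false = refl

module Greedy {k m : ℕ} (d : ℕ) (η D : ℚ) (0≤η : 0ℚ ≤ η) (0≤D : 0ℚ ≤ D) (Dη≡1 : D * η ≡ 1ℚ) where
  open Stage

  n = suc m
  s = suc d
  -- As D = 1 / η, a placed neighbour with η w ≤ M satisfies 2 w ≤ Λ M.
  Λ = D + D
  β = Λ ^ʳ d
  -- The factor 2 absorbs the shift in `recip`: 1 / c ≤ 2 / (c + 1) for c ≥ 1.
  κ = ⟦ 2 ⟧ * ⟦ 3 ⟧ ^ʳ s

  0≤Λ : 0ℚ ≤ Λ
  0≤Λ = 0≤+ 0≤D 0≤D

  0≤β : 0ℚ ≤ β
  0≤β = 0≤^ d 0≤Λ

  1≤3^s : 1ℚ ≤ ⟦ 3 ⟧ ^ʳ s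
  1≤3^s = subst (_≤ ⟦ 3 ⟧ ^ʳ s) (1^ s) (^-monoˡ s 0≤1 (⟦⟧-mono {1} {3} (ℕ.s≤s ℕ.z≤n)))

  0≤κ : 0ℚ ≤ κ
  0≤κ = 0≤* (0≤⟦⟧ 2) (≤-trans 0≤1 1≤3^s)

  -- S is η times the sum of the weights of the placed neighbours of a vertex,
  -- I the reciprocal of the product of their doubled weights, and δ ≤ d is the
  -- number of its neighbours still to be placed.
  Admissible : ℕ → ℚ → ℚ → Set
  Admissible δ S I = ∀ M → S ≤ M → ½ ≤ M → (Λ * M) ^ʳ δ ≤ (Λ * M) ^ʳ d * I

  -- Either `S` already bounds w, or admissibility at M = w gives 1 ≤ (Λ w)ᵈ I, which is then
  -- multiplied by w.
  weight-bound : ∀ {S I w} → 0ℚ ≤ S → 0ℚ ≤ I → ½ ≤ w → Admissible 0 S I → w ≤ S + β * (I * w ^ʳ s)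
  weight-bound {S} {I} {w} 0≤S 0≤I ½≤w adm with ≤-total w S
  ... | inj₁ w≤S = ≤-trans w≤S (≤-by (β * (I * w ^ʳ s)) (0≤* 0≤β (0≤* 0≤I (0≤^ s (≤-trans (nonNegative⁻¹ ½) ½≤w)))) refl)
  ... | inj₂ S≤w = begin
    w                            ≡⟨ *-identityʳ w ⟨
    w * 1ℚ                       ≤⟨ *-monoˡ (≤-trans (nonNegative⁻¹ ½) ½≤w) (adm w S≤w ½≤w) ⟩
    w * ((Λ * w) ^ʳ d * I)       ≡⟨ cong (λ z → w * (z * I)) (^ʳ-distrib-* Λ w d) ⟩
    w * ((β * w ^ʳ d) * I)       ≡⟨ solve 4 (λ w b p i → w :* ((b :* p) :* i) := b :* (i :* (w :* p))) refl w β (w ^ʳ d) I ⟩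
    β * (I * w ^ʳ s)             ≤⟨ ≤-by S 0≤S (+-comm S _) ⟩
    S + β * (I * w ^ʳ s)         ∎
    where open ≤-Reasoning

  -- Placing a neighbour uses up one factor Λ M, which is at least 2 w; hence `I` may be divided by
  -- 2 w.
  admissible-step : ∀ {δ S I w J} → 0ℚ ≤ S → 0ℚ ≤ w → 0ℚ ≤ J → J * (w + w) ≡ 1ℚ →
    Admissible (suc δ) S I → Admissible δ (S + η * w) (I * J)
  admissible-step {δ} {S} {I} {w} {J} 0≤S 0≤w 0≤J J2w≡1 adm M S+ηw≤M ½≤M = begin
    x ^ʳ δ                     ≡⟨ *-identityˡ (x ^ʳ δ) ⟨
    1ℚ * x ^ʳ δ                ≡⟨ cong (_* x ^ʳ δ) J2w≡1 ⟨
    J * (w + w) * x ^ʳ δ       ≡⟨ *-assoc J (w + w) (x ^ʳ δ) ⟩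
    J * ((w + w) * x ^ʳ δ)     ≤⟨ *-monoˡ 0≤J (*-monoʳ (0≤^ δ (0≤* 0≤Λ (≤-trans (nonNegative⁻¹ ½) ½≤M))) 2w≤x) ⟩
    J * (x * x ^ʳ δ)           ≤⟨ *-monoˡ 0≤J (adm M (≤-trans (≤-by (η * w) (0≤* 0≤η 0≤w) refl) S+ηw≤M) ½≤M) ⟩
    J * (x ^ʳ d * I)           ≡⟨ solve 3 (λ j p i → j :* (p :* i) := p :* (i :* j)) refl J (x ^ʳ d) I ⟩
    x ^ʳ d * (I * J)           ∎
    where
    open ≤-Reasoning
    x = Λ * M
    w≤DM : w ≤ D * M
    w≤DM = begin
      w              ≡⟨ *-identityˡ w ⟨
      1ℚ * w         ≡⟨ cong (_* w) Dη≡1 ⟨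
      D * η * w      ≡⟨ *-assoc D η w ⟩
      D * (η * w)    ≤⟨ *-monoˡ 0≤D (≤-trans (≤-by S 0≤S (+-comm S (η * w))) S+ηw≤M) ⟩
      D * M          ∎
    2w≤x : w + w ≤ x
    2w≤x = ≤-trans (+-mono-≤ w≤DM w≤DM) (≤-reflexive (sym (*-distribʳ-+ M D D)))

  -- The bracket estimates the future cost of u in the manner of `weight-bound`. The coefficient
  -- accounts for what this cost will in turn add to the `S` of later vertices.
  potential : ∀ {r} → Stage k m r → (S I : Fin r → ℚ) → ℚ
  potential st S I = sum (λ u → coefficient η (B st) u * (S u + β * (I u * expected s st u)))

  Embedding : ∀ {r} → Stage k m r → Set
  Embedding {r} st = ∃[ q ] ((∀ u → cand st u q (lookup q u) ≡ true) ×
    (∀ u v → u ≢ v → part st u ≡ part st v → lookup q u ≢ lookup q v))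

  module Step {r} (st : Stage k m (suc r)) (S I : Fin (suc r) → ℚ)
    (0≤S : ∀ u → 0ℚ ≤ S u) (0≤I : ∀ u → 0ℚ ≤ I u)
    (adm : ∀ u → Admissible (card (λ v → B st v u)) (S u) (I u))
    (κZ≤n : κ * potential st S I ≤ ⟦ n ⟧) where

    q₀ : Vec (Fin n) (suc r)
    q₀ = replicate (suc r) zero

    C : Fin n → Bool
    C = cand st zero q₀

    C≗ : ∀ q x → cand st zero q x ≡ C x
    C≗ q = cand-zero st q q₀

    c = card C
    w = weight n c
    i = recip c
    t = ⟦ 3 ⟧ ^ʳ s

    0≤t : 0ℚ ≤ t
    0≤t = ≤-trans 0≤1 1≤3^s

    coef : Fin r → ℚ
    coef u = coefficient η (B st) (suc u)

    a = λ u → 𝟙 (B st zero (suc u))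
    J = λ u → discount {k} {m} c (B st zero (suc u))
    e = λ u → expected s st (suc u)
    e′ = expected′ s st C C≗
    b = sum (λ u → coef u * a u)
    c₀ = 1ℚ + η * b
    X₀ = S zero + β * (I zero * expected s st zero)
    ΣS = sum (λ u → coef u * S (suc u))
    G = sum (λ u → coef u * (I (suc u) * e u))
    g = λ x → sum (λ u → coef u * (I (suc u) * (J u * e′ u x)))
    Z = potential st S I

    0≤coef : ∀ u → 0ℚ ≤ coef u
    0≤coef u = 0≤coefficient 0≤η (B st) (suc u)

    0≤w : 0ℚ ≤ w
    0≤w = 0≤weight n c

    1≤c₀ : 1ℚ ≤ c₀
    1≤c₀ = ≤-by (η * b) (0≤* 0≤η (0≤sum (λ u → 0≤* (0≤coef u) (0≤𝟙 (B st zero (suc u)))))) refl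

    w≤X₀ : w ≤ X₀
    w≤X₀ = subst (λ z → w ≤ S zero + β * (I zero * z)) (sym (expected-zero s st q₀))
      (weight-bound (0≤S zero) (0≤I zero) (½≤weight (card-≤n C))
        (subst (λ δ → Admissible δ (S zero) (I zero)) (card-false (B-zero st)) (adm zero)))

    split : ∀ (f h : Fin r → ℚ) → sum (λ u → coef u * (f u + β * h u)) ≡ sum (λ u → coef u * f u) + β * sum (λ u → coef u * h u)
    split f h = begin
      sum (λ u → coef u * (f u + β * h u))
        ≡⟨ sum-cong-≗ (λ u → solve 4 (λ c f b h → c :* (f :+ b :* h) := c :* f :+ b :* (c :* h)) refl (coef u) (f u) β (h u)) ⟩
      sum (λ u → coef u * f u + β * (coef u * h u))
        ≡⟨ ∑-distrib-+ (λ u → coef u * f u) (λ u → β * (coef u * h u)) ⟩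
      sum (λ u → coef u * f u) + sum (λ u → β * (coef u * h u))
        ≡⟨ cong (sum (λ u → coef u * f u) +_) (sym (*-distribˡ-sum β (λ u → coef u * h u))) ⟩
      sum (λ u → coef u * f u) + β * sum (λ u → coef u * h u) ∎
      where open ≡-Reasoning

    Z≡ : Z ≡ c₀ * X₀ + (ΣS + β * G)
    Z≡ = cong (c₀ * X₀ +_) (split (λ u → S (suc u)) (λ u → I (suc u) * e u))

    0≤G : 0ℚ ≤ G
    0≤G = 0≤sum (λ u → 0≤* (0≤coef u) (0≤* (0≤I (suc u)) (0≤expected s st (suc u))))

    0≤ΣS : 0ℚ ≤ ΣS
    0≤ΣS = 0≤sum (λ u → 0≤* (0≤coef u) (0≤S (suc u)))

    0≤c₀X₀ : 0ℚ ≤ c₀ * X₀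
    0≤c₀X₀ = 0≤* (≤-trans 0≤1 1≤c₀) (≤-trans 0≤w w≤X₀)

    w≤Z : w ≤ Z
    w≤Z = begin
      w                                 ≤⟨ w≤X₀ ⟩
      X₀                                ≡⟨ *-identityˡ X₀ ⟨
      1ℚ * X₀                           ≤⟨ *-monoʳ (≤-trans 0≤w w≤X₀) 1≤c₀ ⟩
      c₀ * X₀                           ≤⟨ ≤-by (ΣS + β * G) (0≤+ 0≤ΣS (0≤* 0≤β 0≤G)) refl ⟩
      c₀ * X₀ + (ΣS + β * G)            ≡⟨ Z≡ ⟨
      Z                                 ∎
      where open ≤-Reasoning

    -- Without candidates the weight would be n.
    C≢∅ : c ≢ 0
    C≢∅ c≡0 = ≤⇒≯ κn≤n n<κn
      where
      w≡n : w ≡ ⟦ n ⟧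
      w≡n = trans (cong (weight n) c≡0) (trans (cong (⟦ n ⟧ *_) recip-1) (*-identityʳ ⟦ n ⟧))
      κn≤n : ⟦ 2 ⟧ * t * ⟦ n ⟧ ≤ ⟦ n ⟧
      κn≤n = ≤-trans (*-monoˡ 0≤κ (subst (_≤ Z) w≡n w≤Z)) κZ≤n
      n<κn : ⟦ n ⟧ < ⟦ 2 ⟧ * t * ⟦ n ⟧
      n<κn = begin-strict
        ⟦ n ⟧                  ≡⟨ +-identityʳ ⟦ n ⟧ ⟨
        ⟦ n ⟧ + 0ℚ             <⟨ +-monoʳ-< ⟦ n ⟧ (0<⟦suc⟧ m) ⟩
        ⟦ n ⟧ + ⟦ n ⟧          ≡⟨ solve 1 (λ n → n :+ n := con ⟦ 2 ⟧ :* con 1ℚ :* n) refl ⟦ n ⟧ ⟩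
        ⟦ 2 ⟧ * 1ℚ * ⟦ n ⟧     ≤⟨ *-monoʳ (0≤⟦⟧ n) (*-monoˡ (0≤⟦⟧ 2) 1≤3^s) ⟩
        ⟦ 2 ⟧ * t * ⟦ n ⟧      ∎
        where open ≤-Reasoning

    average : sum (λ x → 𝟙 (C x) * g x) ≤ (⟦ c ⟧ + t) * G
    average = begin
      sum (λ x → 𝟙 (C x) * g x)
        ≡⟨ sum-cong-≗ (λ x → trans (*-distribˡ-sum (𝟙 (C x)) (λ u → coef u * (I (suc u) * (J u * e′ u x))))
             (sum-cong-≗ (λ u → solve 4 (λ p c i z → p :* (c :* (i :* z)) := c :* i :* (p :* z)) refl
                (𝟙 (C x)) (coef u) (I (suc u)) (J u * e′ u x)))) ⟩
      sum (λ x → sum (λ u → coef u * I (suc u) * (𝟙 (C x) * (J u * e′ u x))))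
        ≡⟨ ∑-comm (λ x u → coef u * I (suc u) * (𝟙 (C x) * (J u * e′ u x))) ⟩
      sum (λ u → sum (λ x → coef u * I (suc u) * (𝟙 (C x) * (J u * e′ u x))))
        ≡⟨ sum-cong-≗ (λ u → sym (*-distribˡ-sum (coef u * I (suc u)) (λ x → 𝟙 (C x) * (J u * e′ u x)))) ⟩
      sum (λ u → coef u * I (suc u) * sum (λ x → 𝟙 (C x) * (J u * e′ u x)))
        ≤⟨ sum-mono (λ u → *-monoˡ (0≤* (0≤coef u) (0≤I (suc u))) (expected-step s st C C≗ u C≢∅)) ⟩
      sum (λ u → coef u * I (suc u) * ((⟦ c ⟧ + t) * e u))
        ≡⟨ sum-cong-≗ (λ u → solve 4 (λ c i z e → c :* i :* (z :* e) := z :* (c :* (i :* e))) refl (coef u) (I (suc u)) (⟦ c ⟧ + t) (e u)) ⟩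
      sum (λ u → (⟦ c ⟧ + t) * (coef u * (I (suc u) * e u)))
        ≡⟨ *-distribˡ-sum (⟦ c ⟧ + t) (λ u → coef u * (I (suc u) * e u)) ⟨
      (⟦ c ⟧ + t) * G ∎
      where open ≤-Reasoning

    c+t≤ : ∀ l → l ≢ 0 → ⟦ l ⟧ + t ≤ ⟦ l ⟧ * (1ℚ + κ * recip l)
    c+t≤ zero    l≢0 = contradiction refl l≢0
    c+t≤ (suc l) _   = ≤-by (t * (⟦ l ⟧ * ρ)) (0≤* 0≤t (0≤* (0≤⟦⟧ l) (0≤recip (suc l)))) (begin
      ⟦ suc l ⟧ * (1ℚ + κ * ρ)
        ≡⟨ cong (_* (1ℚ + κ * ρ)) (⟦suc⟧ l) ⟩
      (1ℚ + ⟦ l ⟧) * (1ℚ + ⟦ 2 ⟧ * t * ρ)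
        ≡⟨ solve 3 (λ l t p → (con 1ℚ :+ l) :* (con 1ℚ :+ con ⟦ 2 ⟧ :* t :* p)
             := (con 1ℚ :+ l) :+ t :* (p :* (con 1ℚ :+ (con 1ℚ :+ l))) :+ t :* (l :* p)) refl ⟦ l ⟧ t ρ ⟩
      (1ℚ + ⟦ l ⟧) + t * (ρ * (1ℚ + (1ℚ + ⟦ l ⟧))) + t * (⟦ l ⟧ * ρ)
        ≡⟨ cong₂ (λ x y → x + t * y + t * (⟦ l ⟧ * ρ)) (sym (⟦suc⟧ l))
             (trans (cong (ρ *_) (trans (cong (1ℚ +_) (sym (⟦suc⟧ l))) (sym (⟦suc⟧ (suc l))))) (recip-inverse (suc l))) ⟩
      ⟦ suc l ⟧ + t * 1ℚ + t * (⟦ l ⟧ * ρ)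
        ≡⟨ cong (λ z → ⟦ suc l ⟧ + z + t * (⟦ l ⟧ * ρ)) (*-identityʳ t) ⟩
      ⟦ suc l ⟧ + t + t * (⟦ l ⟧ * ρ) ∎)
      where
      open ≡-Reasoning
      ρ = recip (suc l)

    -- The new values of `S` and `I` are the same for all candidates, so only the moments collected
    -- in `g` have to be averaged.
    choice : ∃[ x ] (C x ≡ true × g x ≤ (1ℚ + κ * i) * G)
    choice = weighted-attained C g ((1ℚ + κ * i) * G) C≢∅
      (≤-trans average (≤-trans (*-monoʳ 0≤G (c+t≤ c C≢∅)) (≤-reflexive (*-assoc ⟦ c ⟧ (1ℚ + κ * i) G))))

    x₀ : Fin n
    x₀ = proj₁ choice

    x∈C : ∀ q → cand st zero q x₀ ≡ true
    x∈C q = trans (C≗ q x₀) (proj₁ (proj₂ choice))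

    st′ : Stage k m r
    st′ = next st x₀ x∈C

    S′ I′ : Fin r → ℚ
    S′ u = S (suc u) + a u * (η * w)
    I′ u = I (suc u) * J u

    0≤S′ : ∀ u → 0ℚ ≤ S′ u
    0≤S′ u = 0≤+ (0≤S (suc u)) (0≤* (0≤𝟙 (B st zero (suc u))) (0≤* 0≤η 0≤w))

    0≤I′ : ∀ u → 0ℚ ≤ I′ u
    0≤I′ u = 0≤* (0≤I (suc u)) (0≤discount {k} {m} c (B st zero (suc u)))

    discount-true : discount {k} {m} c true * (w + w) ≡ 1ℚ
    discount-true = begin
      ½ * ⟦ suc c ⟧ * ν * (⟦ n ⟧ * i + ⟦ n ⟧ * i)
        ≡⟨ solve 4 (λ c v n i → con ½ :* c :* v :* (n :* i :+ n :* i) := v :* n :* (i :* c)) refl ⟦ suc c ⟧ ν ⟦ n ⟧ i ⟩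
      ν * ⟦ n ⟧ * (i * ⟦ suc c ⟧)
        ≡⟨ cong₂ _*_ (recip-inverse m) (recip-inverse c) ⟩
      1ℚ * 1ℚ
        ≡⟨ *-identityˡ 1ℚ ⟩
      1ℚ ∎
      where
      open ≡-Reasoning
      ν = recip m

    adm′ : ∀ u → Admissible (card (λ v → B st′ v u)) (S′ u) (I′ u)
    adm′ u = by-cases (B st zero (suc u)) refl
      where
      δ = card (λ v → B st (suc v) (suc u))
      by-cases : ∀ b → B st zero (suc u) ≡ b →
        Admissible δ (S (suc u) + 𝟙 b * (η * w)) (I (suc u) * discount {k} {m} c b)
      by-cases true  eq = subst (λ z → Admissible δ (S (suc u) + z) (I (suc u) * discount {k} {m} c true)) (sym (*-identityˡ (η * w)))
        (admissible-step {δ} {S (suc u)} {I (suc u)} {w} (0≤S (suc u)) 0≤w (0≤discount {k} {m} c true) discount-true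
          (subst (λ z → Admissible z (S (suc u)) (I (suc u))) (card-head (λ v → B st v (suc u)) true eq) (adm (suc u))))
      by-cases false eq = subst₂ (Admissible δ)
        (sym (trans (cong (S (suc u) +_) (*-zeroˡ (η * w))) (+-identityʳ (S (suc u))))) (sym (*-identityʳ (I (suc u))))
        (subst (λ z → Admissible z (S (suc u)) (I (suc u))) (card-head (λ v → B st v (suc u)) false eq) (adm (suc u)))

    Z′≡ : potential st′ S′ I′ ≡ ΣS + η * w * b + β * g x₀
    Z′≡ = begin
      potential st′ S′ I′
        ≡⟨ split S′ (λ u → I′ u * e′ u x₀) ⟩
      sum (λ u → coef u * S′ u) + β * sum (λ u → coef u * (I′ u * e′ u x₀))
        ≡⟨ cong₂ (λ y z → y + β * z)
             (trans (sum-cong-≗ (λ u → solve 4 (λ c s a y → c :* (s :+ a :* y) := c :* s :+ y :* (c :* a)) refl (coef u) (S (suc u)) (a u) (η * w)))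
               (trans (∑-distrib-+ (λ u → coef u * S (suc u)) (λ u → η * w * (coef u * a u)))
                 (cong (ΣS +_) (sym (*-distribˡ-sum (η * w) (λ u → coef u * a u))))))
             (sum-cong-≗ (λ u → cong (coef u *_) (*-assoc (I (suc u)) (J u) (e′ u x₀)))) ⟩
      ΣS + η * w * b + β * g x₀ ∎
      where open ≡-Reasoning

    -- The gain w from no longer counting vertex zero pays for the growth of G.
    Z′≤Z : potential st′ S′ I′ ≤ Z
    Z′≤Z = begin
      potential st′ S′ I′
        ≡⟨ Z′≡ ⟩
      P + β * g x₀
        ≤⟨ +-monoʳ-≤ P (*-monoˡ 0≤β (proj₂ (proj₂ choice))) ⟩
      P + β * ((1ℚ + κ * i) * G)
        ≡⟨ solve 5 (λ p b k i g → p :+ b :* ((con 1ℚ :+ k :* i) :* g) := p :+ b :* g :+ i :* (k :* (b :* g))) refl P β κ i G ⟩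
      P + β * G + i * (κ * (β * G))
        ≤⟨ +-monoʳ-≤ (P + β * G) (*-monoˡ (0≤recip c) κβG≤n) ⟩
      P + β * G + i * ⟦ n ⟧
        ≡⟨ cong (P + β * G +_) (*-comm i ⟦ n ⟧) ⟩
      -- The charges η w to the neighbours and the extra w add up to c₀ w, by the recursion for the
      -- coefficients.
      ΣS + η * w * b + β * G + w
        ≡⟨ solve 5 (λ s e w b g → s :+ e :* w :* b :+ g :+ w := (con 1ℚ :+ e :* b) :* w :+ (s :+ g)) refl ΣS η w b (β * G) ⟩
      c₀ * w + (ΣS + β * G)
        ≤⟨ +-monoˡ-≤ (ΣS + β * G) (*-monoˡ (≤-trans 0≤1 1≤c₀) w≤X₀) ⟩
      c₀ * X₀ + (ΣS + β * G)
        ≡⟨ Z≡ ⟨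
      Z ∎
      where
      open ≤-Reasoning
      P = ΣS + η * w * b
      κβG≤n : κ * (β * G) ≤ ⟦ n ⟧
      κβG≤n = ≤-trans (*-monoˡ 0≤κ (≤-trans
        (≤-by (c₀ * X₀ + ΣS) (0≤+ 0≤c₀X₀ 0≤ΣS) (solve 3 (λ x y z → x :+ (y :+ z) := z :+ (x :+ y)) refl (c₀ * X₀) ΣS (β * G)))
        (≤-reflexive (sym Z≡)))) κZ≤n

    extend : Embedding st′ → Embedding st
    extend (q , q∈cand , distinct) = x₀ ∷ q , ∈cand , distinct′
      where
      ∈cand : ∀ u → cand st u (x₀ ∷ q) (lookup (x₀ ∷ q) u) ≡ true
      ∈cand zero    = x∈C (x₀ ∷ q)
      ∈cand (suc u) = &∖⇒ {k} {m} (samePart st u) (cand st (suc u) (x₀ ∷ q)) x₀ (lookup q u) (q∈cand u)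
      x₀-fresh : ∀ v → part st zero ≡ part st (suc v) → x₀ ≢ lookup q v
      x₀-fresh v p = &∖-≢ {k} {m} (samePart st v) (cand st (suc v) (x₀ ∷ q)) x₀ (lookup q v) (samePart-≡ st v p) (q∈cand v)
      distinct′ : ∀ u v → u ≢ v → part st u ≡ part st v → lookup (x₀ ∷ q) u ≢ lookup (x₀ ∷ q) v
      distinct′ zero    zero    u≢v p = contradiction refl u≢v
      distinct′ zero    (suc v) u≢v p = x₀-fresh v p
      distinct′ (suc u) zero    u≢v p = λ e → x₀-fresh u (sym p) (sym e)
      distinct′ (suc u) (suc v) u≢v p = distinct u v (λ e → u≢v (cong suc e)) p

  -- The potential never grows, so κ Z ≤ n persists and every step finds a candidate.
  embed : ∀ r (st : Stage k m r) (S I : Fin r → ℚ) → (∀ u → 0ℚ ≤ S u) → (∀ u → 0ℚ ≤ I u) →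
    (∀ u → Admissible (card (λ v → B st v u)) (S u) (I u)) →
    κ * potential st S I ≤ ⟦ n ⟧ → Embedding st
  embed zero    st S I _ _ _ _ = [] , (λ ()) , λ ()
  embed (suc r) st S I 0≤S 0≤I adm κZ≤n =
    extend (embed r st′ S′ I′ 0≤S′ 0≤I′ adm′ (≤-trans (*-monoˡ 0≤κ Z′≤Z) κZ≤n))
    where open Step st S I 0≤S 0≤I adm κZ≤n

-- Complete boxes of tuples and their density

∧-elim : ∀ {a b} → a ∧ b ≡ true → a ≡ true × b ≡ true
∧-elim {true} e = refl , e

all-elim : ∀ {A : Set} (p : A → Bool) {xs} → all p xs ≡ true → ∀ {x} → x ∈ xs → p x ≡ true
all-elim p e (here refl) = proj₁ (∧-elim e)
all-elim p {x ∷ xs} e (there x∈xs) = all-elim p (proj₂ (∧-elim {p x} e)) x∈xs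

all-intro : ∀ {A : Set} (p : A → Bool) {xs} → (∀ {x} → x ∈ xs → p x ≡ true) → all p xs ≡ true
all-intro p {[]} h = refl
all-intro p {x ∷ xs} h rewrite h (here refl) = all-intro p (λ x∈xs → h (there x∈xs))

bool-ext : ∀ {a b} → (a ≡ true → b ≡ true) → (b ≡ true → a ≡ true) → a ≡ b
bool-ext {true}          f g = sym (f refl)
bool-ext {false} {true}  f g = g refl
bool-ext {false} {false} f g = refl

-- Tells whether `g` contains the complete k-partite hypergraph on the parts `os j`.
box : ∀ {A : Set} {k} → (Vec A k → Bool) → (Fin k → List A) → Bool
box {k = zero}  g os = g []
box {k = suc k} g os = all (λ a → box (λ y → g (a ∷ y)) (λ j → os (suc j))) (os zero)

box-elim : ∀ {A : Set} {k} (g : Vec A k → Bool) os → box g os ≡ true →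
  ∀ y → (∀ j → lookup y j ∈ os j) → g y ≡ true
box-elim g os e []      h = e
box-elim g os e (a ∷ y) h = box-elim (λ z → g (a ∷ z)) (λ j → os (suc j))
  (all-elim (λ b → box (λ z → g (b ∷ z)) (λ j → os (suc j))) e (h zero)) y (λ j → h (suc j))

box-intro : ∀ {A : Set} {k} (g : Vec A k → Bool) os →
  (∀ y → (∀ j → lookup y j ∈ os j) → g y ≡ true) → box g os ≡ true
box-intro {k = zero}  g os h = h [] λ ()
box-intro {k = suc k} g os h = all-intro (λ a → box (λ y → g (a ∷ y)) (λ j → os (suc j))) λ {a} a∈ →
  box-intro (λ y → g (a ∷ y)) (λ j → os (suc j)) λ y y∈ → h (a ∷ y) λ { zero → a∈ ; (suc j) → y∈ j }

box-mono : ∀ {A : Set} {k} (g : Vec A k → Bool) {os os′} → (∀ j {a} → a ∈ os j → a ∈ os′ j) →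
  box g os′ ≡ true → box g os ≡ true
box-mono g {os} {os′} sub e = box-intro g os λ y y∈ → box-elim g os′ e y (λ j → sub j (y∈ j))

box-cong : ∀ {A : Set} {k} (g : Vec A k → Bool) {os os′} → (∀ j → os j ≡ os′ j) → box g os ≡ box g os′
box-cong g e = bool-ext (box-mono g (λ j → subst (_ ∈_) (sym (e j)))) (box-mono g (λ j → subst (_ ∈_) (e j)))

rows : ∀ {A : Set} {s k} → Vec (Vec A s) k → Fin k → List A
rows T j = toList (lookup T j)

module _ {A : Set} (M : Mean A) where
  open Mean M

  mean-all : ∀ s (f : A → Bool) → Mean.E (vector M s) (λ v → 𝟙 (all f (toList v))) ≡ E (λ a → 𝟙 (f a)) ^ʳ s
  mean-all zero    f = refl
  mean-all (suc s) f = begin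
    E (λ a → V.E (λ v → 𝟙 (f a ∧ all f (toList v))))
      ≡⟨ ext (λ a → trans (V.ext (λ v → 𝟙-∧ (f a) (all f (toList v)))) (V.*-homo (𝟙 (f a)) (λ v → 𝟙 (all f (toList v))))) ⟩
    E (λ a → 𝟙 (f a) * V.E (λ v → 𝟙 (all f (toList v))))
      ≡⟨ ext (λ a → trans (cong (𝟙 (f a) *_) (mean-all s f)) (*-comm (𝟙 (f a)) (p ^ʳ s))) ⟩
    E (λ a → p ^ʳ s * 𝟙 (f a))
      ≡⟨ *-homo (p ^ʳ s) (λ a → 𝟙 (f a)) ⟩
    p ^ʳ s * p
      ≡⟨ *-comm (p ^ʳ s) p ⟩
    p ^ʳ suc s ∎
    where
    open ≡-Reasoning
    module V = Mean (vector M s)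
    p = E (λ a → 𝟙 (f a))

  -- One application of Jensen's inequality doubles up a coordinate, the other
  -- one carries the resulting density through the remaining coordinates.
  box-density : ∀ s k (g : Vec A k → Bool) →
    Mean.E (vector M k) (λ y → 𝟙 (g y)) ^ʳ (s ℕ.^ k) ≤ Mean.E (vector (vector M s) k) (λ T → 𝟙 (box g (rows T)))
  box-density s zero    g = ≤-reflexive (*-identityʳ (𝟙 (g [])))
  box-density s (suc k) g = begin
    p ^ʳ (s ℕ.* s ℕ.^ k)
      ≡⟨ ^ʳ-assocʳ p s (s ℕ.^ k) ⟨
    (p ^ʳ s) ^ʳ (s ℕ.^ k)
      ≤⟨ ^-monoˡ (s ℕ.^ k) (0≤^ s (0≤E (λ a → K.0≤E (λ y → 0≤𝟙 (g (a ∷ y)))))) p^s≤ ⟩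
    S.E density ^ʳ (s ℕ.^ k)
      ≤⟨ S.jensen (s ℕ.^ k) (λ t → K.0≤E (λ y → 0≤𝟙 (link t y))) ⟩
    S.E (λ t → density t ^ʳ (s ℕ.^ k))
      ≤⟨ S.mono (λ t → box-density s k (link t)) ⟩
    S.E (λ t → SK.E (λ T → 𝟙 (box (link t) (rows T))))
      ≤⟨ S.mono (λ t → SK.mono (λ T → 𝟙-mono (unlink t T))) ⟩
    S.E (λ t → SK.E (λ T → 𝟙 (box g (rows (t ∷ T))))) ∎
    where
    open ≤-Reasoning
    module K = Mean (vector M k)
    module S = Mean (vector M s)
    module SK = Mean (vector (vector M s) k)
    p = E (λ a → K.E (λ y → 𝟙 (g (a ∷ y))))
    -- The common link of the vertices in `t`.
    link : Vec A s → Vec A k → Bool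
    link t y = all (λ a → g (a ∷ y)) (toList t)
    density : Vec A s → ℚ
    density t = K.E (λ y → 𝟙 (link t y))
    p^s≤ : p ^ʳ s ≤ S.E density
    p^s≤ = begin
      p ^ʳ s
        ≡⟨ cong (_^ʳ s) (swap K.linear (λ a y → 𝟙 (g (a ∷ y)))) ⟩
      K.E (λ y → E (λ a → 𝟙 (g (a ∷ y)))) ^ʳ s
        ≤⟨ K.jensen s (λ y → 0≤E (λ a → 0≤𝟙 (g (a ∷ y)))) ⟩
      K.E (λ y → E (λ a → 𝟙 (g (a ∷ y))) ^ʳ s)
        ≡⟨ K.ext (λ y → mean-all s (λ a → g (a ∷ y))) ⟨
      K.E (λ y → S.E (λ t → 𝟙 (link t y)))
        ≡⟨ K.swap S.linear (λ y t → 𝟙 (link t y)) ⟩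
      S.E density ∎
    unlink : ∀ t T → box (link t) (rows T) ≡ true → box g (rows (t ∷ T)) ≡ true
    unlink t T e = box-intro g (rows (t ∷ T)) λ
      { (a ∷ y) h → all-elim (λ b → g (b ∷ y)) (box-elim (link t) (rows T) e y (λ j → h (suc j))) (h zero) }

-- Dependent random choice

module Host {k m h s : ℕ} (g : Vec (Fin (suc m)) k → Bool) (part : Fin h → Fin k) (es : List (Fin k → Fin h)) where
  private
    n = suc m

  Rows = Vec (Vec (Fin n) s) k
  Images = Vec (Fin n) h

  -- A vertex of H counts as placed at time `t` if its number is below `t`.
  placed : Images → ℕ → (Fin k → Fin h) → Fin k → List (Fin n)
  placed q t e j = if ⌊ Fin.toℕ (e j) ℕ.<? t ⌋ then lookup q (e j) ∷ [] else []

  options : Rows → Images → ℕ → (Fin k → Fin h) → Fin k → List (Fin n)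
  options T q t e j = rows T j ++ placed q t e j

  pinned : Fin k → Fin n → Rows → Images → ℕ → (Fin k → Fin h) → Fin k → List (Fin n)
  pinned i x T q t e j = if ⌊ j Fin.≟ i ⌋ then x ∷ [] else options T q t e j

  -- Ranges over the edges through `u`, recognised by their vertex in the part of `u`.
  atEdges : Fin h → ((Fin k → Fin h) → Bool) → Bool
  atEdges u f = all (λ e → not ⌊ e (part u) Fin.≟ u ⌋ ∨ f e) es

  cand : Rows → Fin h → Images → Fin n → Bool
  cand T u q x = atEdges u (λ e → box g (pinned (part u) x T q (Fin.toℕ u) e))

  valid : Rows → Fin h → Images → Bool
  valid T u q = atEdges u (λ e → box g (options T q (Fin.toℕ u) e))

  atEdges-elim : ∀ u f → atEdges u f ≡ true → ∀ {e} → e ∈ es → e (part u) ≡ u → f e ≡ true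
  atEdges-elim u f eq {e} e∈ eu = strip (e (part u) Fin.≟ u) (all-elim (λ e → not ⌊ e (part u) Fin.≟ u ⌋ ∨ f e) eq e∈)
    where
    strip : (d : Dec (e (part u) ≡ u)) → not ⌊ d ⌋ ∨ f e ≡ true → f e ≡ true
    strip (yes _) p = p
    strip (no ¬p) _ = contradiction eu ¬p

  atEdges-intro : ∀ u f → (∀ {e} → e ∈ es → e (part u) ≡ u → f e ≡ true) → atEdges u f ≡ true
  atEdges-intro u f h = all-intro (λ e → not ⌊ e (part u) Fin.≟ u ⌋ ∨ f e) λ {e} e∈ → guard e∈ (e (part u) Fin.≟ u)
    where
    guard : ∀ {e} → e ∈ es → (d : Dec (e (part u) ≡ u)) → not ⌊ d ⌋ ∨ f e ≡ true
    guard e∈ (yes eu) = h e∈ eu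
    guard e∈ (no _)   = refl

  atEdges-cong : ∀ u {f f′} → (∀ {e} → e ∈ es → e (part u) ≡ u → f e ≡ f′ e) → atEdges u f ≡ atEdges u f′
  atEdges-cong u {f} {f′} h = bool-ext
    (λ eq → atEdges-intro u f′ (λ e∈ eu → trans (sym (h e∈ eu)) (atEdges-elim u f eq e∈ eu)))
    (λ eq → atEdges-intro u f (λ e∈ eu → trans (h e∈ eu) (atEdges-elim u f′ eq e∈ eu)))

  pinned-cong : ∀ i x T T′ q q′ t e → (∀ j → j ≢ i → options T q t e j ≡ options T′ q′ t e j) →
    ∀ j → pinned i x T q t e j ≡ pinned i x T′ q′ t e j
  pinned-cong i x T T′ q q′ t e h j with j Fin.≟ i
  ... | yes _ = refl
  ... | no j≢i = h j j≢i

  -- In the part of `u` the vertex `x` is pinned, so this row of `T` is never consulted.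
  cand-resample : ∀ T u q X x → cand (T [ part u ]≔ X) u q x ≡ cand T u q x
  cand-resample T u q X x = atEdges-cong u λ {e} _ _ → box-cong g
    (pinned-cong (part u) x (T [ part u ]≔ X) T q q (Fin.toℕ u) e
      (λ j j≢i → cong (λ v → toList v ++ placed q (Fin.toℕ u) e j) (lookup∘update′ j≢i T X)))

  -- Validity covers every tuple whose entry in the part of `u` is a row element; pinning one such
  -- `x` shrinks the box.
  row⊆cand : ∀ T u q → valid T u q ≡ true → ∀ {x} → x ∈ rows T (part u) → cand T u q x ≡ true
  row⊆cand T u q ok {x} x∈ = atEdges-intro u _ λ {e} e∈ eu → box-mono g (sub e) (atEdges-elim u _ ok e∈ eu)
    where
    sub : ∀ e j {a} → a ∈ pinned (part u) x T q (Fin.toℕ u) e j → a ∈ options T q (Fin.toℕ u) e j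
    sub e j a∈ with j Fin.≟ part u
    sub e .(part u) (here refl) | yes refl = ∈-++⁺ˡ x∈
    ... | no _ = a∈

  private
    module T = Mean (vector (vector (uniform m) s) k)
    module Q = Mean (vector (uniform m) h)
    module X = Mean (vector (uniform m) s)
    module U = Mean (uniform m)

  hostCost : Fin h → Rows → Images → ℚ
  hostCost u T q = 𝟙 (valid T u q) * weight n (card (cand T u q)) ^ʳ s

  -- A valid T has T (part u) among the candidates of u, which do not depend on
  -- T (part u): given a candidate set C, this has probability at most (|C| / n)ˢ.
  expected-cost : ∀ u → T.E (λ T → Q.E (hostCost u T)) ≤ 1ℚ
  expected-cost u = begin
    T.E (λ T → Q.E (λ q → hostCost u T q))
      ≡⟨ T.swap Q.linear (λ T q → hostCost u T q) ⟩
    Q.E (λ q → T.E (λ T → hostCost u T q))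
      ≤⟨ Q.mono fixed ⟩
    Q.E (λ _ → 1ℚ)
      ≡⟨ Q.const 1ℚ ⟩
    1ℚ ∎
    where
    open ≤-Reasoning
    W : Rows → Images → ℚ
    W T q = weight n (card (cand T u q)) ^ʳ s
    0≤W : ∀ T q → 0ℚ ≤ W T q
    0≤W T q = 0≤^ s (0≤weight n (card (cand T u q)))
    resampled : ∀ q T X → hostCost u (T [ part u ]≔ X) q ≤ W T q * 𝟙 (all (cand T u q) (toList X))
    resampled q T X = begin
      𝟙 (valid T′ u q) * W T′ q
        ≡⟨ cong (λ c → 𝟙 (valid T′ u q) * weight n c ^ʳ s) (card-cong (cand-resample T u q X)) ⟩
      𝟙 (valid T′ u q) * W T q
        ≤⟨ *-monoʳ (0≤W T q) (𝟙-mono X⊆cand) ⟩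
      𝟙 (all (cand T u q) (toList X)) * W T q
        ≡⟨ *-comm (𝟙 (all (cand T u q) (toList X))) (W T q) ⟩
      W T q * 𝟙 (all (cand T u q) (toList X)) ∎
      where
      T′ = T [ part u ]≔ X
      X⊆cand : valid T′ u q ≡ true → all (cand T u q) (toList X) ≡ true
      X⊆cand ok = all-intro (cand T u q) λ {x} x∈ → trans (sym (cand-resample T u q X x))
        (row⊆cand T′ u q ok (subst (λ v → x ∈ toList v) (sym (lookup∘update (part u) T X)) x∈))
    -- The shift in `weight` is on the safe side: c / (c + 1) ≤ 1.
    bound : ∀ c → weight n c * (recip m * ⟦ c ⟧) ≤ 1ℚ
    bound c = begin
      ⟦ n ⟧ * recip c * (recip m * ⟦ c ⟧)
        ≡⟨ solve 4 (λ n i v c → n :* i :* (v :* c) := v :* n :* (i :* c)) refl ⟦ n ⟧ (recip c) (recip m) ⟦ c ⟧ ⟩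
      recip m * ⟦ n ⟧ * (recip c * ⟦ c ⟧)
        ≡⟨ trans (cong (_* (recip c * ⟦ c ⟧)) (recip-inverse m)) (*-identityˡ (recip c * ⟦ c ⟧)) ⟩
      recip c * ⟦ c ⟧
        ≤⟨ *-monoˡ (0≤recip c) (⟦⟧-mono (ℕ.n≤1+n c)) ⟩
      recip c * ⟦ suc c ⟧
        ≡⟨ recip-inverse c ⟩
      1ℚ ∎
    average : ∀ q T → X.E (λ X → W T q * 𝟙 (all (cand T u q) (toList X))) ≤ 1ℚ
    average q T = begin
      X.E (λ X → W T q * 𝟙 (all (cand T u q) (toList X)))
        ≡⟨ X.*-homo (W T q) (λ X → 𝟙 (all (cand T u q) (toList X))) ⟩
      W T q * X.E (λ X → 𝟙 (all (cand T u q) (toList X)))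
        ≡⟨ cong (W T q *_) (trans (mean-all (uniform m) s (cand T u q)) (cong (λ z → (recip m * z) ^ʳ s) (sum-𝟙 (cand T u q)))) ⟩
      W T q * (recip m * ⟦ c ⟧) ^ʳ s
        ≡⟨ ^ʳ-distrib-* (weight n c) (recip m * ⟦ c ⟧) s ⟨
      (weight n c * (recip m * ⟦ c ⟧)) ^ʳ s
        ≤⟨ ^-monoˡ s (0≤* (0≤weight n c) (0≤* (0≤recip m) (0≤⟦⟧ c))) (bound c) ⟩
      1ℚ ^ʳ s
        ≡⟨ 1^ s ⟩
      1ℚ ∎
      where c = card (cand T u q)
    fixed : ∀ q → T.E (λ T → hostCost u T q) ≤ 1ℚ
    fixed q = begin
      T.E (λ T → hostCost u T q)
        ≡⟨ resample (vector (uniform m) s) (λ T → hostCost u T q) (part u) ⟩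
      T.E (λ T → X.E (λ X → hostCost u (T [ part u ]≔ X) q))
        ≤⟨ T.mono (λ T → ≤-trans (X.mono (resampled q T)) (average q T)) ⟩
      T.E (λ _ → 1ℚ)
        ≡⟨ T.const 1ℚ ⟩
      1ℚ ∎

-- From complete rows to an embedding

module HostStage {k m h d : ℕ} (g : Vec (Fin (suc m)) k → Bool) (part : Fin h → Fin k) (es : List (Fin k → Fin h))
  (partOK : ∀ {e} → e ∈ es → ∀ i → part (e i) ≡ i)
  (B : Fin h → Fin h → Bool) (B-< : ∀ v u → B v u ≡ true → v Fin.< u) (B-part : ∀ v u → B v u ≡ true → part v ≢ part u)
  (B-edge : ∀ {e} → e ∈ es → ∀ i j → e i Fin.< e j → B (e i) (e j) ≡ true)
  (degree : ∀ u → card (λ v → B v u) ℕ.≤ d)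
  where

  private
    n = suc m
    s = suc d

  open Host {k} {m} {h} {s} g part es

  placed-cong : ∀ q q′ t e j → (Fin.toℕ (e j) ℕ.< t → lookup q (e j) ≡ lookup q′ (e j)) → placed q t e j ≡ placed q′ t e j
  placed-cong q q′ t e j h with Fin.toℕ (e j) ℕ.<? t
  ... | yes ej<t = cong (_∷ []) (h ej<t)
  ... | no  _    = refl

  -- A placed vertex of an edge through `u` is a `B`-neighbour of `u` by `B-edge`, so it differs
  -- from `v`.
  options-local : ∀ T u v q x → B v u ≡ false → ∀ {e} → e ∈ es → e (part u) ≡ u → ∀ j →
    options T (q [ v ]≔ x) (Fin.toℕ u) e j ≡ options T q (Fin.toℕ u) e j
  options-local T u v q x Bvu {e} e∈ eu j = cong (rows T j ++_)
    (placed-cong (q [ v ]≔ x) q (Fin.toℕ u) e j λ ej<u → lookup∘update′ (ej≢v ej<u) q x)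
    where
    ej≢v : e j Fin.< u → e j ≢ v
    ej≢v ej<u refl = contradiction
      (trans (sym Bvu) (subst (λ w → B (e j) w ≡ true) eu (B-edge e∈ j (part u) (subst (e j Fin.<_) (sym eu) ej<u)))) λ ()

  ∈-placed : ∀ q t e j → Fin.toℕ (e j) ℕ.< t → lookup q (e j) ∈ placed q t e j
  ∈-placed q t e j ej<t with Fin.toℕ (e j) ℕ.<? t
  ... | yes _    = here refl
  ... | no  ej≮t = contradiction ej<t ej≮t

  placed-∈ : ∀ q t e j {a} → a ∈ placed q t e j → Fin.toℕ (e j) ℕ.< t × a ≡ lookup q (e j)
  placed-∈ q t e j a∈ with Fin.toℕ (e j) ℕ.<? t
  placed-∈ q t e j (here a≡) | yes ej<t = ej<t , a≡

  module _ (T : Rows) (complete : box g (rows T) ≡ true) where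

    options-pred : ∀ q t e j → Fin.toℕ (e j) ≢ t → ∀ {a} → a ∈ options T q (suc t) e j → a ∈ options T q t e j
    options-pred q t e j ej≢t a∈ with ∈-++⁻ (rows T j) a∈
    ... | inj₁ a∈T = ∈-++⁺ˡ a∈T
    ... | inj₂ a∈p = ∈-++⁺ʳ (rows T j) (subst (_∈ placed q t e j) (sym (proj₂ p))
                       (∈-placed q t e j (ℕ.≤∧≢⇒< (ℕ.s≤s⁻¹ (proj₁ p)) ej≢t)))
      where p = placed-∈ q (suc t) e j a∈p

    -- Induction on `t`, starting from the complete rows. At time t + 1, a tuple has in the part of
    -- vertex t either a row element, and then the previous box covers it, or the image of vertex t,
    -- and then the candidacy of that image does. Other parts gain no options, since vertex t is the
    -- vertex of an edge in at most one part.
    boxes : ∀ q t → (∀ v → Fin.toℕ v ℕ.< t → cand T v q (lookup q v) ≡ true) →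
      ∀ {e} → e ∈ es → box g (options T q t e) ≡ true
    boxes q zero c {e} e∈ = box-mono g sub complete
      where
      sub : ∀ j {a} → a ∈ options T q zero e j → a ∈ rows T j
      sub j a∈ with ∈-++⁻ (rows T j) a∈
      ... | inj₁ a∈T = a∈T
      ... | inj₂ a∈p = contradiction (proj₁ (placed-∈ q zero e j a∈p)) λ ()
    boxes q (suc t) c {e} e∈ = by-cases (any? (λ j → Fin.toℕ (e j) ℕ.≟ t))
      where
      before : box g (options T q t e) ≡ true
      before = boxes q t (λ v v<t → c v (ℕ.m<n⇒m<1+n v<t)) e∈
      by-cases : Dec (∃[ j ] Fin.toℕ (e j) ≡ t) → box g (options T q (suc t) e) ≡ true
      by-cases (no ¬j) = box-mono g (λ j → options-pred q t e j (λ ej≡t → ¬j (j , ej≡t))) before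
      by-cases (yes (i , ei≡t)) = box-intro g (options T q (suc t) e) inside
        where
        v = e i
        pv≡i : part v ≡ i
        pv≡i = partOK e∈ i
        others : ∀ j → j ≢ i → Fin.toℕ (e j) ≢ t
        others j j≢i ej≡t = j≢i (trans (sym (partOK e∈ j))
          (trans (cong part (Fin.toℕ-injective (trans ej≡t (sym ei≡t)))) pv≡i))
        pinned-box : box g (pinned i (lookup q v) T q t e) ≡ true
        pinned-box = subst₂ (λ l t → box g (pinned l (lookup q v) T q t e) ≡ true) pv≡i ei≡t
          (atEdges-elim v _ (c v (ℕ.≤-reflexive (cong suc ei≡t))) e∈ (cong e pv≡i))
        inside : ∀ y → (∀ j → lookup y j ∈ options T q (suc t) e j) → g y ≡ true
        inside y y∈ with ∈-++⁻ (rows T i) (y∈ i)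
        ... | inj₁ y∈T = box-elim g (options T q t e) before y λ j → old j (j Fin.≟ i)
          where
          old : ∀ j → Dec (j ≡ i) → lookup y j ∈ options T q t e j
          old j (yes refl) = ∈-++⁺ˡ y∈T
          old j (no j≢i)   = options-pred q t e j (others j j≢i) (y∈ j)
        ... | inj₂ y∈p = box-elim g (pinned i (lookup q v) T q t e) pinned-box y new
          where
          new : ∀ j → lookup y j ∈ pinned i (lookup q v) T q t e j
          new j with j Fin.≟ i
          ... | yes refl = here (proj₂ (placed-∈ q (suc t) e i y∈p))
          ... | no j≢i   = options-pred q t e j (others j j≢i) (y∈ j)

    hostStage : Stage k m h
    hostStage = record
      { part  = part
      ; B     = B
      ; cand  = cand T
      ; valid = valid T
      ; B-<    = B-<
      ; B-part = B-part
      ; cand-local = λ u v q x Bvu y → atEdges-cong u λ {e} e∈ eu → box-cong g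
          (pinned-cong (part u) y T T (q [ v ]≔ x) q (Fin.toℕ u) e λ j _ → options-local T u v q x Bvu e∈ eu j)
      ; valid-local = λ u v q x Bvu → atEdges-cong u λ e∈ eu → box-cong g (options-local T u v q x Bvu e∈ eu)
      ; valid-cand = λ u q c → atEdges-intro u _ λ e∈ _ → boxes q (Fin.toℕ u) (λ v → c v) e∈
      }

    -- At time h all vertices are placed, so their images are among the options.
    embedding-edge : ∀ q → (∀ v → cand T v q (lookup q v) ≡ true) → ∀ {e} → e ∈ es →
      g (tabulate (λ j → lookup q (e j))) ≡ true
    embedding-edge q c {e} e∈ = box-elim g (options T q h e) (boxes q h (λ v _ → c v) e∈) (tabulate (λ j → lookup q (e j)))
      λ j → subst (_∈ options T q h e j) (sym (lookup∘tabulate (λ j → lookup q (e j)) j))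
        (∈-++⁺ʳ (rows T j) (∈-placed q h e j (Fin.toℕ<n (e j))))

  private
    module T = Mean (vector (vector (uniform m) s) k)
    module Q = Mean (vector (uniform m) h)

  choose-rows : ∀ {δ δ⁻¹ A} (c : Fin h → ℚ) → (∀ u → 0ℚ ≤ c u) → sum c ≤ A → 0ℚ < A → 0ℚ ≤ δ⁻¹ → δ⁻¹ * δ ≡ 1ℚ →
    δ ≤ T.E (λ T → 𝟙 (box g (rows T))) →
    ∃[ T ] (box g (rows T) ≡ true × sum (λ u → c u * Q.E (hostCost u T)) ≤ (A + A) * δ⁻¹)
  choose-rows {δ} {δ⁻¹} {A} c 0≤c Σc≤A 0<A 0≤δ⁻¹ δ⁻¹δ≡1 dense = finish (T.attained Ef≤Eg)
    where
    open ≤-Reasoning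
    X = (A + A) * δ⁻¹
    total : Rows → ℚ
    total T = sum (λ u → c u * Q.E (hostCost u T))
    0≤total : ∀ T → 0ℚ ≤ total T
    0≤total T = 0≤sum λ u → 0≤* (0≤c u) (Q.0≤E λ q → 0≤* (0≤𝟙 (valid T u q)) (0≤^ s (0≤weight n (card (cand T u q)))))
    0≤A = <⇒≤ 0<A
    E-total : T.E total ≤ A
    E-total = begin
      T.E total
        ≡⟨ T.sum-homo (λ u T → c u * Q.E (hostCost u T)) ⟩
      sum (λ u → T.E (λ T → c u * Q.E (hostCost u T)))
        ≡⟨ sum-cong-≗ (λ u → T.*-homo (c u) (λ T → Q.E (hostCost u T))) ⟩
      sum (λ u → c u * T.E (λ T → Q.E (hostCost u T)))
        ≤⟨ sum-mono (λ u → *-monoˡ (0≤c u) (expected-cost u)) ⟩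
      sum (λ u → c u * 1ℚ)
        ≡⟨ sum-cong-≗ (λ u → *-identityʳ (c u)) ⟩
      sum c
        ≤⟨ Σc≤A ⟩
      A ∎
    Ef≤Eg : T.E (λ T → total T + A) ≤ T.E (λ T → X * 𝟙 (box g (rows T)))
    Ef≤Eg = begin
      T.E (λ T → total T + A)
        ≡⟨ trans (T.+-homo total (λ _ → A)) (cong (T.E total +_) (T.const A)) ⟩
      T.E total + A
        ≤⟨ +-monoˡ-≤ A E-total ⟩
      A + A
        ≡⟨ trans (sym (*-identityʳ (A + A))) (trans (cong ((A + A) *_) (sym δ⁻¹δ≡1)) (sym (*-assoc (A + A) δ⁻¹ δ))) ⟩
      X * δ
        ≤⟨ *-monoˡ (0≤* (0≤+ 0≤A 0≤A) 0≤δ⁻¹) dense ⟩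
      X * T.E (λ T → 𝟙 (box g (rows T)))
        ≡⟨ T.*-homo X (λ T → 𝟙 (box g (rows T))) ⟨
      T.E (λ T → X * 𝟙 (box g (rows T))) ∎
    finish : ∃[ T ] total T + A ≤ X * 𝟙 (box g (rows T)) → ∃[ T ] (box g (rows T) ≡ true × total T ≤ X)
    finish (T , p) = T , decide (box g (rows T)) refl , (begin
      total T                      ≤⟨ ≤-by A 0≤A refl ⟩
      total T + A                  ≤⟨ p ⟩
      X * 𝟙 (box g (rows T))       ≤⟨ *-monoˡ (0≤* (0≤+ 0≤A 0≤A) 0≤δ⁻¹) (𝟙≤1 (box g (rows T))) ⟩
      X * 1ℚ                       ≡⟨ *-identityʳ X ⟩
      X                            ∎)
      where
      decide : ∀ b → box g (rows T) ≡ b → box g (rows T) ≡ true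
      decide true  e = e
      decide false e = contradiction
        (<-≤-trans 0<A (≤-by (total T) (0≤total T) (+-comm (total T) A)))
        (≤⇒≯ (subst (total T + A ≤_) (trans (cong (λ b → X * 𝟙 b) e) (*-zeroʳ X)) p))

  module _ (η D : ℚ) (0≤η : 0ℚ ≤ η) (1≤D : 1ℚ ≤ D) (Dη≡1 : D * η ≡ 1ℚ) (ηd≤½ : η * ⟦ d ⟧ ≤ ½) where
    private
      module G = Greedy {k} {m} d η D 0≤η (≤-trans 0≤1 1≤D) Dη≡1

    host-embedding : ∀ {δ δ⁻¹} → 0ℚ ≤ δ⁻¹ → δ⁻¹ * δ ≡ 1ℚ → δ ≤ T.E (λ T → 𝟙 (box g (rows T))) → 0ℚ < ⟦ h ⟧ →
      G.κ * (G.β * ((⟦ h ⟧ + ⟦ h ⟧ + (⟦ h ⟧ + ⟦ h ⟧)) * δ⁻¹)) ≤ ⟦ n ⟧ →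
      ∃[ q ] ((∀ {e} → e ∈ es → g (tabulate (λ j → lookup q (e j))) ≡ true) ×
              (∀ u v → u ≢ v → part u ≡ part v → lookup q u ≢ lookup q v))
    host-embedding 0≤δ⁻¹ δ⁻¹δ≡1 dense 0<h small = finish embedded
      where
      Found : Set
      Found = ∃[ q ] ((∀ {e} → e ∈ es → g (tabulate (λ j → lookup q (e j))) ≡ true) ×
                      (∀ u v → u ≢ v → part u ≡ part v → lookup q u ≢ lookup q v))
      c = coefficient η B
      chosen = choose-rows c (0≤coefficient 0≤η B) (sum-coefficient-≤2r d 0≤η ηd≤½ B degree)
        (+-mono-< 0<h 0<h) 0≤δ⁻¹ δ⁻¹δ≡1 dense
      T = proj₁ chosen
      complete = proj₁ (proj₂ chosen)
      st = hostStage T complete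
      -- Nothing is placed yet, so these are the empty sum and the empty product.
      S I : Fin h → ℚ
      S _ = 0ℚ
      I _ = 1ℚ
      adm : ∀ u → G.Admissible (card (λ v → B v u)) 0ℚ 1ℚ
      adm u M _ ½≤M = subst ((G.Λ * M) ^ʳ card (λ v → B v u) ≤_) (sym (*-identityʳ ((G.Λ * M) ^ʳ d))) (^-monoʳ 1≤ΛM (degree u))
        where
        open ≤-Reasoning
        -- Hence powers of Λ M grow with the exponent, and in-degrees may be replaced by d.
        1≤ΛM : 1ℚ ≤ G.Λ * M
        1≤ΛM = begin
          1ℚ             ≤⟨ 1≤D ⟩
          D              ≡⟨ solve 1 (λ d → d := (d :+ d) :* con ½) refl D ⟩
          G.Λ * ½        ≤⟨ *-monoˡ G.0≤Λ ½≤M ⟩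
          G.Λ * M        ∎
      e : Fin h → ℚ
      e u = Q.E (hostCost u T)
      potential≡ : G.potential st S I ≡ G.β * sum (λ u → c u * e u)
      potential≡ = begin
        sum (λ u → c u * (0ℚ + G.β * (1ℚ * e u)))
          ≡⟨ sum-cong-≗ {x = λ u → c u * (0ℚ + G.β * (1ℚ * e u))} {y = λ u → G.β * (c u * e u)}
               (λ u → solve 3 (λ c b e → c :* (con 0ℚ :+ b :* (con 1ℚ :* e)) := b :* (c :* e)) refl (c u) G.β (e u)) ⟩
        sum (λ u → G.β * (c u * e u))
          ≡⟨ *-distribˡ-sum G.β (λ u → c u * e u) ⟨
        G.β * sum (λ u → c u * e u) ∎
        where open ≡-Reasoning
      small′ : G.κ * G.potential st S I ≤ ⟦ n ⟧
      small′ = ≤-trans (*-monoˡ {p = G.potential st S I} G.0≤κ (≤-trans (≤-reflexive potential≡)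
        (*-monoˡ {p = sum (λ u → c u * e u)} G.0≤β (proj₂ (proj₂ chosen))))) small
      embedded : G.Embedding st
      embedded = G.embed h st S I (λ _ → ≤-refl) (λ _ → 0≤1) adm small′
      finish : G.Embedding st → Found
      finish (q , q∈cand , distinct) = q , embedding-edge T complete q q∈cand , distinct

-- Degeneracy orders of the guest hypergraph

card-injection : ∀ {a b} {P : Fin a → Bool} {Q : Fin b → Bool} (π : Fin a → Fin b) → Injective _≡_ _≡_ π →
  (∀ v → P v ≡ true → Q (π v) ≡ true) → card P ℕ.≤ card Q
card-injection {zero} π inj h = ℕ.z≤n
card-injection {suc a} {P = P} {Q} π inj h with P zero in P₀
... | false = card-injection (λ v → π (suc v)) (λ e → Fin.suc-injective (inj e)) (λ v → h (suc v))
... | true  = subst (suc (card (λ v → P (suc v))) ℕ.≤_) (sym (card-∖ Q (π zero) (h zero P₀)))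
  (ℕ.s≤s (card-injection (λ v → π (suc v)) (λ e → Fin.suc-injective (inj e)) (λ v Pv → keep v (h (suc v) Pv))))
  where
  keep : ∀ v → Q (π (suc v)) ≡ true → (Q ∖ π zero) (π (suc v)) ≡ true
  keep v e with π zero Fin.≟ π (suc v)
  ... | yes p = contradiction (inj p) λ ()
  ... | no  _ rewrite e = refl

∣tabulate∣ : ∀ {h} (f : Fin h → Bool) → ∣ tabulate f ∣ ≡ card f
∣tabulate∣ {zero} f = refl
∣tabulate∣ {suc h} f with f zero
... | true  = cong suc (∣tabulate∣ (λ i → f (suc i)))
... | false = ∣tabulate∣ (λ i → f (suc i))

⌊⌋-true : ∀ {P : Set} (P? : Dec P) → P → ⌊ P? ⌋ ≡ true
⌊⌋-true (yes _) p = refl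
⌊⌋-true (no ¬p) p = contradiction p ¬p

true-⌊⌋ : ∀ {P : Set} (P? : Dec P) → ⌊ P? ⌋ ≡ true → P
true-⌊⌋ (yes p) _ = p

<?-suc : ∀ {n} (u v : Fin n) → ⌊ u Fin.<? v ⌋ ≡ ⌊ suc u Fin.<? suc v ⌋
<?-suc u v = bool-ext
  (λ e → ⌊⌋-true (suc u Fin.<? suc v) (ℕ.s≤s (true-⌊⌋ (u Fin.<? v) e)))
  (λ e → ⌊⌋-true (u Fin.<? v) (ℕ.s≤s⁻¹ (true-⌊⌋ (suc u Fin.<? suc v) e)))

any-elim : ∀ {A : Set} (p : A → Bool) {xs} → any p xs ≡ true → ∃[ x ] (x ∈ xs × p x ≡ true)
any-elim p {x ∷ xs} e with p x in px
... | true  = x , here refl , px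
... | false = let (y , y∈ , py) = any-elim p {xs} e in y , there y∈ , py

any-intro : ∀ {A : Set} (p : A → Bool) {xs x} → x ∈ xs → p x ≡ true → any p xs ≡ true
any-intro p (here refl) e rewrite e = refl
any-intro p {y ∷ xs} (there x∈) e with p y
... | true  = refl
... | false = any-intro p x∈ e

anyFin-elim : ∀ m (f : Fin m → Bool) → anyFin m f ≡ true → ∃[ i ] f i ≡ true
anyFin-elim (suc m) f e with f zero in f₀
... | true  = zero , f₀
... | false = let (i , fi) = anyFin-elim m (λ x → f (suc x)) e in suc i , fi

anyFin-intro : ∀ m (f : Fin m → Bool) i → f i ≡ true → anyFin m f ≡ true
anyFin-intro (suc m) f zero e rewrite e = refl
anyFin-intro (suc m) f (suc i) e with f zero
... | true  = refl
... | false = anyFin-intro m (λ x → f (suc x)) i e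

module _ {k h : ℕ} (H : KPartite k h) where
  private
    joins : Fin h → Fin h → (Fin k → Fin h) → Bool
    joins u v e = anyFin k (λ i → anyFin k (λ j → ⌊ e i Fin.≟ u ⌋ ∧ ⌊ e j Fin.≟ v ⌋))

  -- An edge has one vertex in each part, so two of its vertices in the same part coincide.
  adj-part : ∀ u v → adj H u v ≡ true → part H u ≢ part H v
  adj-part u v e pu≡pv = u≢v u≡v
    where
    u≢v : u ≢ v
    u≢v refl with u Fin.≟ u
    u≢v refl | no u≢u = u≢u refl
    witness = any-elim (joins u v) (proj₂ (∧-elim {not ⌊ u Fin.≟ v ⌋} e))
    edge = proj₁ witness
    ok = All.lookup (partOK H) (proj₁ (proj₂ witness))
    outer = anyFin-elim k _ (proj₂ (proj₂ witness))
    inner = anyFin-elim k _ (proj₂ outer)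
    i = proj₁ outer
    j = proj₁ inner
    ei≡u : edge i ≡ u
    ei≡u = true-⌊⌋ (edge i Fin.≟ u) (proj₁ (∧-elim (proj₂ inner)))
    ej≡v : edge j ≡ v
    ej≡v = true-⌊⌋ (edge j Fin.≟ v) (proj₂ (∧-elim {⌊ edge i Fin.≟ u ⌋} (proj₂ inner)))
    i≡j : i ≡ j
    i≡j = trans (sym (ok i)) (trans (cong (part H) ei≡u) (trans pu≡pv (trans (cong (part H) (sym ej≡v)) (ok j))))
    u≡v : u ≡ v
    u≡v = trans (sym ei≡u) (trans (cong edge i≡j) ej≡v)

  adj-edge : ∀ {e} → e ∈ edges H → ∀ i j → e i ≢ e j → adj H (e i) (e j) ≡ true
  adj-edge {e} e∈ i j ei≢ej with e i Fin.≟ e j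
  ... | yes p = contradiction p ei≢ej
  ... | no  _ = any-intro (joins (e i) (e j)) e∈ (anyFin-intro k _ i (anyFin-intro k _ j
    (cong₂ _∧_ (⌊⌋-true (e i Fin.≟ e i) refl) (⌊⌋-true (e j Fin.≟ e j) refl))))

  -- A degeneracy order of `S`: every vertex has at most d neighbours after it.
  record Elimination (d : ℕ) (S : Subset h) : Set where
    field
      size : ℕ
      σ : Fin size → Fin h
      σ∈ : ∀ v → σ v ∈ˢ S
      injective : Injective _≡_ _≡_ σ
      onto : ∀ w → w ∈ˢ S → ∃[ v ] σ v ≡ w
      later : ∀ u → card (λ v → ⌊ u Fin.<? v ⌋ ∧ adj H (σ v) (σ u)) ℕ.≤ d

  ∉-remove : ∀ {l} (S : Subset l) v → ¬ v ∈ˢ (S -ˢ v)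
  ∉-remove (true  ∷ S) zero ()
  ∉-remove (false ∷ S) zero ()
  ∉-remove (true  ∷ S) (suc v) (Vec.there p) = ∉-remove S v p
  ∉-remove (false ∷ S) (suc v) (Vec.there p) = ∉-remove S v p

  -- A vertex of degree at most d in `S` comes first, since all later vertices lie in `S`. The bound
  -- `b` on the size makes the recursion terminate.
  eliminate : ∀ {d} → Degenerate H d → ∀ b S → ∣ S ∣ ℕ.≤ b → Elimination d S
  eliminate {d} deg b S ∣S∣≤b with nonempty? S
  ... | no ¬S = record
    { size = 0 ; σ = λ () ; σ∈ = λ () ; injective = λ {x} → contradiction x λ ()
    ; onto = λ w w∈ → contradiction (w , w∈) ¬S ; later = λ () }
  eliminate {d} deg zero S ∣S∣≤b | yes (w , w∈) =
    contradiction (ℕ.<-≤-trans (x∈p⇒∣p-x∣<∣p∣ w∈) ∣S∣≤b) λ ()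
  eliminate {d} deg (suc b) S ∣S∣≤b | yes S≢∅ = record
    { size = suc R.size ; σ = σ ; σ∈ = σ∈ ; injective = injective ; onto = onto ; later = later }
    where
    v₀ = proj₁ (deg S S≢∅)
    v₀∈S = proj₁ (proj₂ (deg S S≢∅))
    module R = Elimination (eliminate deg b (S -ˢ v₀) (ℕ.s≤s⁻¹ (ℕ.<-≤-trans (x∈p⇒∣p-x∣<∣p∣ v₀∈S) ∣S∣≤b)))
    σ : Fin (suc R.size) → Fin h
    σ zero    = v₀
    σ (suc v) = R.σ v
    σ∈ : ∀ v → σ v ∈ˢ S
    σ∈ zero    = v₀∈S
    σ∈ (suc v) = p─q⊆p S _ (R.σ∈ v)
    fresh : ∀ v → R.σ v ≢ v₀
    fresh v e = ∉-remove S v₀ (subst (_∈ˢ (S -ˢ v₀)) e (R.σ∈ v))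
    injective : Injective _≡_ _≡_ σ
    injective {zero}  {zero}  e = refl
    injective {zero}  {suc v} e = contradiction (sym e) (fresh v)
    injective {suc u} {zero}  e = contradiction e (fresh u)
    injective {suc u} {suc v} e = cong suc (R.injective e)
    onto : ∀ w → w ∈ˢ S → ∃[ v ] σ v ≡ w
    onto w w∈ with w Fin.≟ v₀
    ... | yes w≡v₀ = zero , sym w≡v₀
    ... | no  w≢v₀ = let (v , e) = R.onto w (x∈p∧x≢y⇒x∈p-y w∈ w≢v₀) in suc v , e
    later : ∀ u → card (λ v → ⌊ u Fin.<? v ⌋ ∧ adj H (σ v) (σ u)) ℕ.≤ d
    later zero = ℕ.≤-trans
      (card-injection {Q = λ w → ⌊ w ∈? S ⌋ ∧ adj H w v₀} σ injective
        (λ v e → cong₂ _∧_ (⌊⌋-true (σ v ∈? S) (σ∈ v)) (proj₂ (∧-elim {⌊ zero {R.size} Fin.<? v ⌋} e))))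
      (subst (ℕ._≤ d) (∣tabulate∣ (λ w → ⌊ w ∈? S ⌋ ∧ adj H w v₀)) (proj₂ (proj₂ (deg S S≢∅))))
    later (suc u) = subst (ℕ._≤ d) (card-cong (λ v → cong (_∧ adj H (R.σ v) (R.σ u)) (<?-suc u v))) (R.later u)

-- Edge counts as means

-- The summation in edgeCount and the functions to which it applies G are local
-- to its definition; metavariables solved by unification give access to them.

mutual
  partialSum : ∀ k N (G : PartiteGraph (suc k) N) m → (Fin m → ℕ) → ℕ
  partialSum = _

  private
    partialSum-solution : ∀ k n b → ∃[ x ] x ≡ edgeCount (suc k) (suc n) (λ _ → b)
    partialSum-solution k n b with edgeCount k (suc n) (λ _ → b)
    -- These abstractions leave distinct variables as arguments, so unification determines the
    -- metavariable.
    ... | c with suc n | (λ (_ : Fin (suc k) → Fin (suc n)) → b) | (λ (_ : Fin n) → c)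
    ... | N | G | f = c ℕ.+ partialSum k N G n f , refl

mutual
  emptyCount : ∀ N (G : PartiteGraph 0 N) → Bool → ℕ
  emptyCount = _

  private
    emptyCount-solution : ∀ n b → ∃[ x ] x ≡ edgeCount 0 n (λ _ → b)
    emptyCount-solution n b with (λ (_ : Fin 0 → Fin n) → b)
    ... | G = emptyCount n G b , refl

⟦partialSum⟧ : ∀ k N G m f → ⟦ partialSum k N G m f ⟧ ≡ sum (λ i → ⟦ f i ⟧)
⟦partialSum⟧ k N G zero    f = refl
⟦partialSum⟧ k N G (suc m) f = trans (⟦⟧-+ (f zero) (partialSum k N G m (λ i → f (suc i))))
  (cong (⟦ f zero ⟧ +_) (⟦partialSum⟧ k N G m (λ i → f (suc i))))

⟦emptyCount⟧ : ∀ N G b → ⟦ emptyCount N G b ⟧ ≡ 𝟙 b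
⟦emptyCount⟧ N G true  = refl
⟦emptyCount⟧ N G false = refl

edgeCount-zero : ∀ n (G : PartiteGraph 0 n) → Σ[ f ∈ (Fin 0 → Fin n) ] edgeCount 0 n G ≡ emptyCount n G (G f)
edgeCount-zero n G = _ , refl

edgeCount-suc : ∀ k n (G : PartiteGraph (suc k) n) → Σ[ link ∈ (Fin n → PartiteGraph k n) ] (
  edgeCount (suc k) n G ≡ partialSum k n G n (λ i → edgeCount k n (link i)) ×
  (∀ i f → Σ[ f′ ∈ (Fin (suc k) → Fin n) ] (link i f ≡ G f′ × f′ zero ≡ i × (∀ j → f′ (suc j) ≡ f j))))
edgeCount-suc k n G = _ , refl , λ i f → _ , refl , refl , λ j → refl

-- Functions on Fin k need not be equal when they agree pointwise, so the
-- embedding argument works with a copy g of G on vectors.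
record Copy {k m : ℕ} (G : PartiteGraph k (suc m)) : Set where
  field
    g : Vec (Fin (suc m)) k → Bool
    count : ⟦ edgeCount k (suc m) G ⟧ ≡ ⟦ suc m ⟧ ^ʳ k * Mean.E (vector (uniform m) k) (λ y → 𝟙 (g y))
    edge : ∀ y → g y ≡ true → ∃[ f ] (G f ≡ true × (∀ j → f j ≡ lookup y j))

copy : ∀ k {m} (G : PartiteGraph k (suc m)) → Copy G
copy zero {m} G = record
  { g = λ _ → G f
  ; count = trans (cong ⟦_⟧ (proj₂ (edgeCount-zero (suc m) G))) (trans (⟦emptyCount⟧ (suc m) G (G f)) (sym (*-identityˡ (𝟙 (G f)))))
  ; edge = λ y e → f , e , λ ()
  }
  where f = proj₁ (edgeCount-zero (suc m) G)
copy (suc k) {m} G = record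
  { g = g
  ; count = begin
      ⟦ edgeCount (suc k) n G ⟧
        ≡⟨ cong ⟦_⟧ (proj₁ (proj₂ links)) ⟩
      ⟦ partialSum k n G n (λ i → edgeCount k n (link i)) ⟧
        ≡⟨ ⟦partialSum⟧ k n G n (λ i → edgeCount k n (link i)) ⟩
      sum (λ i → ⟦ edgeCount k n (link i) ⟧)
        ≡⟨ sum-cong-≗ (λ i → Copy.count (C i)) ⟩
      sum (λ i → N * d i)
        ≡⟨ *-distribˡ-sum N d ⟨
      N * sum d
        ≡⟨ trans (sym (*-identityˡ (N * sum d))) (cong (_* (N * sum d)) (sym (recip-inverse m))) ⟩
      recip m * ⟦ n ⟧ * (N * sum d)
        ≡⟨ solve 4 (λ v n N s → v :* n :* (N :* s) := n :* N :* (v :* s)) refl (recip m) ⟦ n ⟧ N (sum d) ⟩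
      ⟦ n ⟧ * N * (recip m * sum d) ∎
  ; edge = edge
  }
  where
  open ≡-Reasoning
  n = suc m
  N = ⟦ n ⟧ ^ʳ k
  links = edgeCount-suc k n G
  link = proj₁ links
  C = λ i → copy k (link i)
  d = λ i → Mean.E (vector (uniform m) k) (λ y → 𝟙 (Copy.g (C i) y))
  g : Vec (Fin n) (suc k) → Bool
  g (i ∷ y) = Copy.g (C i) y
  edge : ∀ y → g y ≡ true → ∃[ f ] (G f ≡ true × (∀ j → f j ≡ lookup y j))
  edge (i ∷ y) e =
    let (f , link-f , f≗y) = Copy.edge (copy k (link i)) y e
        (f′ , link≡ , f₀ , fₛ) = proj₂ (proj₂ links) i f
    in f′ , trans (sym link≡) link-f , λ { zero → f₀ ; (suc j) → trans (fₛ j) (f≗y j) }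

-- The guest hypergraph in its embedding order

-- The elimination order is reversed: vertices are embedded starting from the
-- one eliminated last, so that each has at most d earlier neighbours.
module Ordered {k h d : ℕ} (H : KPartite k h) (elim : Elimination H d ⊤) where
  open Elimination elim

  order : Fin size → Fin h
  order v = σ (opposite v)

  opposite-injective : ∀ {r} → Injective _≡_ _≡_ (opposite {r})
  opposite-injective {x = u} {v} e =
    trans (sym (Fin.opposite-involutive u)) (trans (cong opposite e) (Fin.opposite-involutive v))

  position : Fin h → Fin size
  position w = opposite (proj₁ (onto w ∈⊤))

  order-position : ∀ w → order (position w) ≡ w
  order-position w = trans (cong σ (Fin.opposite-involutive _)) (proj₂ (onto w ∈⊤))

  size≤h : size ℕ.≤ h
  size≤h = Fin.injective⇒≤ injective

  back : Fin size → Fin size → Bool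
  back v u = ⌊ v Fin.<? u ⌋ ∧ adj H (order v) (order u)

  opposite-< : ∀ {r} {v u : Fin r} → v Fin.< u → opposite u Fin.< opposite v
  opposite-< {r} {v} {u} v<u = subst₂ ℕ._<_ (sym (Fin.opposite-prop u)) (sym (Fin.opposite-prop v))
    (ℕ.∸-monoʳ-< (ℕ.s≤s v<u) (Fin.toℕ<n u))

  back-degree : ∀ u → card (λ v → back v u) ℕ.≤ d
  back-degree u = ℕ.≤-trans
    (card-injection {Q = λ v → ⌊ opposite u Fin.<? v ⌋ ∧ adj H (σ v) (order u)} opposite opposite-injective
      (λ v e → cong₂ _∧_
        (⌊⌋-true (opposite u Fin.<? opposite v) (opposite-< (true-⌊⌋ (v Fin.<? u) (proj₁ (∧-elim e)))))
        (proj₂ (∧-elim {⌊ v Fin.<? u ⌋} e))))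
    (later (opposite u))

  edges′ : List (Fin k → Fin size)
  edges′ = List.map (position ∘_) (edges H)

  part′ : Fin size → Fin k
  part′ v = part H (order v)

  edges′-elim : ∀ {e′} → e′ ∈ edges′ → Σ[ e ∈ (Fin k → Fin h) ] (e ∈ edges H × e′ ≡ position ∘ e)
  edges′-elim = ∈-map⁻ (position ∘_)

  part′-ok : ∀ {e′} → e′ ∈ edges′ → ∀ i → part′ (e′ i) ≡ i
  part′-ok e′∈ i with edges′-elim e′∈
  ... | e , e∈ , refl = trans (cong (part H) (order-position (e i))) (All.lookup (partOK H) e∈ i)

  back-< : ∀ v u → back v u ≡ true → v Fin.< u
  back-< v u e = true-⌊⌋ (v Fin.<? u) (proj₁ (∧-elim e))

  back-part : ∀ v u → back v u ≡ true → part′ v ≢ part′ u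
  back-part v u e = adj-part H (order v) (order u) (proj₂ (∧-elim {⌊ v Fin.<? u ⌋} e))

  back-edge : ∀ {e′} → e′ ∈ edges′ → ∀ i j → e′ i Fin.< e′ j → back (e′ i) (e′ j) ≡ true
  back-edge e′∈ i j lt with edges′-elim e′∈
  ... | e , e∈ , refl = cong₂ _∧_ (⌊⌋-true (position (e i) Fin.<? position (e j)) lt)
    (subst₂ (λ a b → adj H a b ≡ true) (sym (order-position (e i))) (sym (order-position (e j)))
      (adj-edge H e∈ i j (λ ei≡ej → Fin.<-irrefl (cong position ei≡ej) lt)))

  -- Each vertex stays in its own part, so images need to be distinct only within a part.
  contains : ∀ {m} (G : PartiteGraph k (suc m)) (q : Vec (Fin (suc m)) size) →
    (∀ {e′} → e′ ∈ edges′ → Copy.g (copy k G) (tabulate (λ j → lookup q (e′ j))) ≡ true) →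
    (∀ u v → u ≢ v → part′ u ≡ part′ v → lookup q u ≢ lookup q v) → Contains G H
  contains {m} G q q-edge distinct = φ , φ-injective , All.tabulate φ-edge
    where
    φ : Fin h → Fin k × Fin (suc m)
    φ w = part H w , lookup q (position w)
    φ-injective : Injective _≡_ _≡_ φ
    φ-injective {v} {w} e with position v Fin.≟ position w
    ... | yes p = trans (sym (order-position v)) (trans (cong order p) (order-position w))
    ... | no ¬p = contradiction (cong proj₂ e) (distinct (position v) (position w) ¬p
      (trans (cong (part H) (order-position v)) (trans (cong proj₁ e) (cong (part H) (sym (order-position w))))))
    φ-edge : ∀ {e} → e ∈ edges H → ∃[ f ] (G f ≡ true × (∀ j → ∃[ i ] (φ (e j) ≡ (i , f i))))
    φ-edge {e} e∈ = f , Gf , λ j → j , cong₂ _,_ (All.lookup (partOK H) e∈ j)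
      (sym (trans (f≗ j) (lookup∘tabulate (λ j → lookup q (position (e j))) j)))
      where
      found = Copy.edge (copy k G) (tabulate (λ j → lookup q (position (e j)))) (q-edge (∈-map⁺ (position ∘_) e∈))
      f = proj₁ found
      Gf = proj₁ (proj₂ found)
      f≗ = proj₂ (proj₂ found)

-- Choice of the constant and conclusion

module Constants (p : ℚ) (0<p : 0ℚ < p) (k d′ : ℕ) where
  d s : ℕ
  d = suc d′
  s = suc d

  D η δ : ℚ
  -- This is 2 d, because d = d′ + 1; accordingly η = 1 / 2d.
  D = ⟦ suc (d′ ℕ.+ d) ⟧
  η = recip (d′ ℕ.+ d)
  -- The proportion of complete `T` guaranteed by `box-density`.
  δ = p ^ʳ (s ℕ.^ k)

  0<δ : 0ℚ < δ
  0<δ = 0<^ (s ℕ.^ k) 0<p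

  δ⁻¹ κ β X Y : ℚ
  δ⁻¹ = proj₁ (reciprocal 0<δ)
  κ = ⟦ 2 ⟧ * ⟦ 3 ⟧ ^ʳ s
  β = (D + D) ^ʳ d
  -- One factor 2 comes from the sum of the coefficients, the other from `choose-rows`.
  X = ⟦ 4 ⟧ * δ⁻¹
  Y = κ * (β * X)

  1≤D : 1ℚ ≤ D
  1≤D = ⟦⟧-mono {1} {suc (d′ ℕ.+ d)} (ℕ.s≤s ℕ.z≤n)

  0<D : 0ℚ < D
  0<D = 0<⟦suc⟧ (d′ ℕ.+ d)

  Dη≡1 : D * η ≡ 1ℚ
  Dη≡1 = trans (*-comm D η) (recip-inverse (d′ ℕ.+ d))

  ηd≤½ : η * ⟦ d ⟧ ≤ ½
  ηd≤½ = ≤-reflexive (begin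
    η * ⟦ d ⟧                  ≡⟨ solve 2 (λ e d → e :* d := e :* (d :+ d) :* con ½) refl η ⟦ d ⟧ ⟩
    η * (⟦ d ⟧ + ⟦ d ⟧) * ½    ≡⟨ cong (λ z → η * z * ½) (⟦⟧-+ d d) ⟨
    η * D * ½                  ≡⟨ cong (_* ½) (recip-inverse (d′ ℕ.+ d)) ⟩
    1ℚ * ½                     ≡⟨ *-identityˡ ½ ⟩
    ½                          ∎)
    where open ≡-Reasoning

  0<δ⁻¹ : 0ℚ < δ⁻¹
  0<δ⁻¹ = proj₁ (proj₂ (reciprocal 0<δ))

  δ⁻¹δ≡1 : δ⁻¹ * δ ≡ 1ℚ
  δ⁻¹δ≡1 = proj₂ (proj₂ (reciprocal 0<δ))

  0<κ : 0ℚ < κ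
  0<κ = 0<* (0<⟦suc⟧ 1) (0<^ s (0<⟦suc⟧ 2))

  0<β : 0ℚ < β
  0<β = 0<^ d (+-mono-< 0<D 0<D)

  0<Y : 0ℚ < Y
  0<Y = 0<* 0<κ (0<* 0<β (0<* (0<⟦suc⟧ 3) 0<δ⁻¹))

  -- With c = 1 / Y, the bound h ≤ c n makes the initial value of κ Z at most n.
  c : ℚ
  c = proj₁ (reciprocal 0<Y)

  0<c : 0ℚ < c
  0<c = proj₁ (proj₂ (reciprocal 0<Y))

  cY≡1 : c * Y ≡ 1ℚ
  cY≡1 = proj₂ (proj₂ (reciprocal 0<Y))

  dense : ∀ {m} (G : PartiteGraph k (suc m)) → p * ⟦ suc m ℕ.^ k ⟧ ≤ ⟦ edgeCount k (suc m) G ⟧ →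
    δ ≤ Mean.E (vector (vector (uniform m) s) k) (λ T → 𝟙 (box (Copy.g (copy k G)) (rows T)))
  dense {m} G pnᵏ≤ = ≤-trans (^-monoˡ (s ℕ.^ k) (<⇒≤ 0<p) p≤)
    (box-density (uniform m) s k (Copy.g (copy k G)))
    where
    E = Mean.E (vector (uniform m) k) (λ y → 𝟙 (Copy.g (copy k G) y))
    p≤ : p ≤ E
    p≤ = *-cancelˡ (0<^ k (0<⟦suc⟧ m)) (subst₂ _≤_
      (trans (cong (p *_) (⟦⟧-^ (suc m) k)) (*-comm p (⟦ suc m ⟧ ^ʳ k))) (Copy.count (copy k G)) pnᵏ≤)

  small : ∀ {r h n} → r ℕ.≤ h → ⟦ h ⟧ ≤ c * ⟦ n ⟧ → κ * (β * ((⟦ r ⟧ + ⟦ r ⟧ + (⟦ r ⟧ + ⟦ r ⟧)) * δ⁻¹)) ≤ ⟦ n ⟧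
  small {r} {h} {n} r≤h h≤cn = begin
    κ * (β * ((⟦ r ⟧ + ⟦ r ⟧ + (⟦ r ⟧ + ⟦ r ⟧)) * δ⁻¹))
      ≡⟨ solve 4 (λ k b r i → k :* (b :* ((r :+ r :+ (r :+ r)) :* i)) := k :* (b :* (con ⟦ 4 ⟧ :* i)) :* r) refl κ β ⟦ r ⟧ δ⁻¹ ⟩
    Y * ⟦ r ⟧
      ≤⟨ *-monoˡ (<⇒≤ 0<Y) (≤-trans (⟦⟧-mono r≤h) h≤cn) ⟩
    Y * (c * ⟦ n ⟧)
      ≡⟨ solve 3 (λ y c n → y :* (c :* n) := c :* y :* n) refl Y c ⟦ n ⟧ ⟩
    c * Y * ⟦ n ⟧
      ≡⟨ trans (cong (_* ⟦ n ⟧) cY≡1) (*-identityˡ ⟦ n ⟧) ⟩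
    ⟦ n ⟧ ∎
    where open ≤-Reasoning

  positive-contains : ∀ {m h} (G : PartiteGraph k (suc m)) → p * ⟦ suc m ℕ.^ k ⟧ ≤ ⟦ edgeCount k (suc m) G ⟧ →
    (H : KPartite k (suc h)) → Degenerate H d → ⟦ suc h ⟧ ≤ c * ⟦ suc m ⟧ → Contains G H
  positive-contains {m} {h} G pnᵏ≤ H deg h≤cn = finish found
    where
    elim : Elimination H d ⊤
    elim = eliminate H deg (suc h) ⊤ (∣p∣≤n ⊤)
    open Ordered H elim
    g = Copy.g (copy k G)
    Found : Set
    Found = ∃[ q ] ((∀ {e} → e ∈ edges′ → g (tabulate (λ j → lookup q (e j))) ≡ true) ×
                    (∀ u v → u ≢ v → part′ u ≡ part′ v → lookup q u ≢ lookup q v))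
    0<⟦size⟧ : ∀ {r} → Fin r → 0ℚ < ⟦ r ⟧
    0<⟦size⟧ {suc r} _ = 0<⟦suc⟧ r
    found : Found
    found = HostStage.host-embedding {d = d} g part′ edges′ part′-ok back back-< back-part back-edge back-degree
      η D (0≤recip (d′ ℕ.+ d)) 1≤D Dη≡1 ηd≤½ (<⇒≤ 0<δ⁻¹) δ⁻¹δ≡1 (dense G pnᵏ≤) (0<⟦size⟧ (position zero)) (small {Elimination.size elim} {suc h} {suc m} size≤h h≤cn)
    finish : Found → Contains G H
    finish (q , q-edge , distinct) = contains G q q-edge distinct

theorem5p1 : (p : ℚ) → 0ℚ < p → p < ½ → (k d : ℕ) → 1 ≤ℕ k → 1 ≤ℕ d →
    ∃[ c ] (0ℚ < c × (∀ (n : ℕ) (G : PartiteGraph k n) →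
    p * ⟦ n ^ k ⟧ ≤ ⟦ edgeCount k n G ⟧ →
    ∀ (h : ℕ) (H : KPartite k h) → SkelDegeneracy H d →
    ⟦ h ⟧ ≤ c * ⟦ n ⟧ → Contains G H))
theorem5p1 p 0<p p<½ (suc k) (suc d′) 1≤k 1≤d = c , 0<c , contained
  where
  open Constants p 0<p (suc k) d′
  contained : ∀ n (G : PartiteGraph (suc k) n) → p * ⟦ n ℕ.^ suc k ⟧ ≤ ⟦ edgeCount (suc k) n G ⟧ →
    ∀ h (H : KPartite (suc k) h) → SkelDegeneracy H (suc d′) → ⟦ h ⟧ ≤ c * ⟦ n ⟧ → Contains G H
  -- Without vertices H has no edges, since k ≥ 1 gives each edge a vertex.
  contained n G _ zero H _ _ = (λ ()) , (λ { {()} }) , All.tabulate λ {e} _ → contradiction (e zero) Fin.¬Fin0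
  contained zero G _ (suc h) H _ h≤0 =
    contradiction (<-≤-trans (0<⟦suc⟧ h) (≤-trans h≤0 (≤-reflexive (*-zeroʳ c)))) (<-irrefl refl)
  contained (suc m) G pnᵏ≤ (suc h) H (deg , _) h≤cn = positive-contains G pnᵏ≤ H deg h≤cn
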